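{- If $\mathbb K$ is a computable age, then its embedding information satisfies $\mathscr{EI}(\mathbb K)\leq_{\mathrm T}\mathbf{0'}$. Further, if $\mathbb K$ is a uniformly finite computable age, then $\mathscr{EI}(\mathbb K)$ is computable.
   Context: Languages and structures. $\mathcal{L}$ is a countable language (relation symbols of positive arity; function symbols of any arity, 0-ary ones being constants) with a computable representation: relation symbols $R_n$ and function symbols $F_m$ are indexed bijectively by disjoint computable subsets of $\omega$, with arity computable from the index. An $\mathcal{L}$-structure $\mathcal{M}$ is c.e. if its underlying set $M$ is a c.e. subset of $\omega$ and the sets $\{(n,\mathbf a): \mathcal M\models R_n(\mathbf a)\}$, $\{(n,\mathbf a): \mathcal M\models \neg R_n(\mathbf a)\}$, $\{(m,\mathbf a,b): \mathcal M\models F_m(\mathbf a)=b\}$ are c.e.; it is computable if moreover $M$ is computable. Tuples are finite; $\mathrm{cl}_{\mathcal M}(\mathbf a)$ is the smallest substructure of $\mathcal M$ containing $\mathbf a$. For $\mathbf a\in\mathcal A$, $\mathbf b\in\mathcal B$ of the same length, $\mathbf a\simeq\mathbf b$ means that for every atomic $\mathcal L$-formula $\varphi$, $\mathcal A\models\varphi(\mathbf a)$ iff $\mathcal B\models\varphi(\mathbf b)$; equivalently $\mathbf a\mapsto\mathbf b$ extends to an isomorphism $\mathrm{cl}(\mathbf a)\to\mathrm{cl}(\mathbf b)$. $\mathbf{0'}$ is the Turing jump of the least Turing degree. Ages. An age is a collection of finitely generated $\mathcal L$-structures closed under isomorphism. A computable age (computable representation of an age $\mathcal K$) is a c.e. set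 $\mathbb K$ of triples $(\mathbf a,\mathcal A,i)$ (computable structures being given by indices), with exactly one triple for each $i\in\omega$, written $\mathbb I(i)=(\mathbf a_i,\mathcal A_i,i)$, such that each $\mathcal A_i$ is a computable $\mathcal L$-structure in $\mathcal K$ with $\mathcal A_i=\mathrm{cl}_{\mathcal A_i}(\mathbf a_i)$, and every $\mathcal B\in\mathcal K$ is isomorphic to some $\mathcal A_i$. The embedding information $\mathscr{EI}(\mathbb K)$ is the set of tuples $(\mathbb I(k_0),\mathbf b_0,\mathbb I(k_1),\mathbf b_1)$ with $\mathbf b_0\in\mathcal A_{k_0}$, $\mathbf b_1\in\mathcal A_{k_1}$ and $\mathbf b_0\simeq\mathbf b_1$. A collection $\mathcal K$ of $\mathcal L$-structures is uniformly finite if $\mathcal L$ is a finite language and there is a computable function $f:\omega\to\omega$ such that for all $\mathcal M\in\mathcal K$ and all tuples $\mathbf a\in\mathcal M$ we have $|\mathrm{cl}_{\mathcal M}(\mathbf a)|\leq f(|\mathbf a|)$. -}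

module Defs where

open import Level using (Level; 0ℓ; _⊔_) renaming (suc to lsuc)
open import Data.Nat using (ℕ; zero; suc; _+_; _<_; _≤_)
open import Data.Fin using (Fin)
open import Data.List using (List; length)
import Data.List.Membership.Propositional as List
open import Data.Product using (∃; ∃-syntax; _×_; _,_; proj₁; proj₂)
open import Data.Sum using (_⊎_)
open import Data.Vec using (Vec; []; _∷_; map; lookup)
open import Data.Vec.Relation.Unary.All using (All)
open import Function.Bundles using (_⇔_; _↔_; module Inverse)
open import Relation.Binary.PropositionalEquality using (_≡_)
open import Relation.Nullary using (¬_)
open import Relation.Unary using (Pred; _∈_; _∉_; _≐_; _⊥_; Irrelevant; ∅)

tri : ℕ → ℕ
tri zero    = zero
tri (suc n) = suc n + tri n

-- The Cantor pairing, a bijection ℕ × ℕ → ℕ with inverse unpair.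
⟨_,_⟩ : ℕ → ℕ → ℕ
⟨ x , y ⟩ = tri (x + y) + y

next : ℕ × ℕ → ℕ × ℕ
next (zero  , y) = suc y , zero
next (suc x , y) = x , suc y

unpair : ℕ → ℕ × ℕ
unpair zero    = zero , zero
unpair (suc n) = next (unpair n)

π₁ π₂ : ℕ → ℕ
π₁ n = proj₁ (unpair n)
π₂ n = proj₂ (unpair n)

-- A bijection from tuples of arbitrary finite length to ℕ.
tuple : ∀ {n} → Vec ℕ n → ℕ
tuple []       = 0
tuple (x ∷ xs) = suc ⟨ x , tuple xs ⟩

data Code : Set where
  zero succ left right oracle : Code
  pair comp prec              : Code → Code → Code
  mu                          : Code → Code

-- The graph of the characteristic function of A.
χ : Pred ℕ 0ℓ → ℕ → ℕ → Set
χ A x y = (x ∈ A × y ≡ 1) ⊎ (x ∉ A × y ≡ 0)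

-- Primitive recursion with parameter a on (graphs of) partial functions.
Prec : (F G : ℕ → ℕ → Set) → ℕ → ℕ → ℕ → Set
Prec F G a zero    y = F a y
Prec F G a (suc n) y = ∃[ z ] Prec F G a n z × G ⟨ a , ⟨ n , z ⟩ ⟩ y

-- ⟦ c ⟧ A x y : the program c with oracle A halts on input x with output y.
⟦_⟧ : Code → Pred ℕ 0ℓ → ℕ → ℕ → Set
⟦ zero     ⟧ A x y = y ≡ 0
⟦ succ     ⟧ A x y = y ≡ suc x
⟦ left     ⟧ A x y = y ≡ π₁ x
⟦ right    ⟧ A x y = y ≡ π₂ x
⟦ oracle   ⟧ A x y = χ A x y
⟦ pair c d ⟧ A x y = ∃[ u ] ∃[ v ] ⟦ c ⟧ A x u × ⟦ d ⟧ A x v × y ≡ ⟨ u , v ⟩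
⟦ comp c d ⟧ A x y = ∃[ z ] ⟦ d ⟧ A x z × ⟦ c ⟧ A z y
⟦ prec c d ⟧ A x y = Prec (⟦ c ⟧ A) (⟦ d ⟧ A) (π₁ x) (π₂ x) y
⟦ mu c     ⟧ A x y = ⟦ c ⟧ A ⟨ x , y ⟩ 0 ×
                     (∀ m → m < y → ∃[ v ] ⟦ c ⟧ A ⟨ x , m ⟩ (suc v))

⌜_⌝ : Code → ℕ
⌜ zero     ⌝ = ⟨ 0 , ⟨ 0 , 0 ⟩ ⟩
⌜ succ     ⌝ = ⟨ 1 , ⟨ 0 , 0 ⟩ ⟩
⌜ left     ⌝ = ⟨ 2 , ⟨ 0 , 0 ⟩ ⟩
⌜ right    ⌝ = ⟨ 3 , ⟨ 0 , 0 ⟩ ⟩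
⌜ oracle   ⌝ = ⟨ 4 , ⟨ 0 , 0 ⟩ ⟩
⌜ pair c d ⌝ = ⟨ 5 , ⟨ ⌜ c ⌝ , ⌜ d ⌝ ⟩ ⟩
⌜ comp c d ⌝ = ⟨ 6 , ⟨ ⌜ c ⌝ , ⌜ d ⌝ ⟩ ⟩
⌜ prec c d ⌝ = ⟨ 7 , ⟨ ⌜ c ⌝ , ⌜ d ⌝ ⟩ ⟩
⌜ mu c     ⌝ = ⟨ 8 , ⟨ ⌜ c ⌝ , 0 ⟩ ⟩

-- The graph of the e-th function partial recursive in A.  Numbers that code
-- no program index the nowhere defined function.
Φ : Pred ℕ 0ℓ → ℕ → ℕ → ℕ → Set
Φ A e x y = ∃[ c ] ⌜ c ⌝ ≡ e × ⟦ c ⟧ A x y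

-- Absolute computability is computability with the empty oracle, whose
-- answers are always 0.
φ : ℕ → ℕ → ℕ → Set
φ = Φ ∅

W : ℕ → Pred ℕ 0ℓ
W e x = ∃[ y ] φ e x y

jump : Pred ℕ 0ℓ → Pred ℕ 0ℓ
jump A e = ∃[ y ] Φ A e e y

𝟎′ : Pred ℕ 0ℓ
𝟎′ = jump ∅

infix 4 _≤T_ _Decides_

_≤T_ : Pred ℕ 0ℓ → Pred ℕ 0ℓ → Set
B ≤T A = ∃[ e ] ∀ x y → χ B x y ⇔ Φ A e x y

_Decides_ : ℕ → Pred ℕ 0ℓ → Set
e Decides B = ∀ x y → χ B x y ⇔ φ e x y

Computable : Pred ℕ 0ℓ → Set
Computable B = ∃[ e ] e Decides B

CE : Pred ℕ 0ℓ → Set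
CE B = ∃[ e ] B ≐ W e

ComputableFun : (ℕ → ℕ) → Set
ComputableFun f = ∃[ e ] ∀ x y → y ≡ f x ⇔ φ e x y

-- A symbol is identified with its index.  The values of arity at numbers
-- indexing no symbol are never used.  Irrelevance makes the predicates
-- genuine subsets of ℕ.
record Language : Set₁ where
  field
    Rel Fun        : Pred ℕ 0ℓ
    Rel-irrelevant : Irrelevant Rel
    Fun-irrelevant : Irrelevant Fun
    disjoint       : Rel ⊥ Fun
    arity          : ℕ → ℕ
    positive       : ∀ {n} → n ∈ Rel → 0 < arity n
    Rel-computable   : Computable Rel
    Fun-computable   : Computable Fun
    arity-computable : ComputableFun arity

module _ (L : Language) where
  open Language L

  record Interpretation (A : Set) : Set₁ where
    field
      rel : ∀ {n} → n ∈ Rel → Vec A (arity n) → Set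
      fun : ∀ {m} → m ∈ Fun → Vec A (arity m) → A

  record Structure : Set₁ where
    field
      Carrier        : Set
      interpretation : Interpretation Carrier
    open Interpretation interpretation public

  -- A structure whose underlying set is a subset of ω.
  record ωStructure : Set₁ where
    field
      dom            : Pred ℕ 0ℓ
      dom-irrelevant : Irrelevant dom
      interpretation : Interpretation (∃ dom)

    structure : Structure
    structure = record { Carrier = ∃ dom ; interpretation = interpretation }

  data Term (k : ℕ) : Set where
    var : Fin k → Term k
    app : ∀ {m} → m ∈ Fun → Vec (Term k) (arity m) → Term k

  data Atomic (k : ℕ) : Set where
    app : ∀ {n} → n ∈ Rel → Vec (Term k) (arity n) → Atomic k
    _≈_ : Term k → Term k → Atomic k

module _ {L : Language} where
  open Language L
  open Structure

  infix 4 _≅_ _⊨_[_]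

  record _≅_ (𝓐 𝓑 : Structure L) : Set where
    field
      bijection : Carrier 𝓐 ↔ Carrier 𝓑
    open Inverse bijection using (to)
    field
      rel-iff : ∀ {n} (r : n ∈ Rel) as → rel 𝓐 r as ⇔ rel 𝓑 r (map to as)
      fun-eq  : ∀ {m} (f : m ∈ Fun) as → to (fun 𝓐 f as) ≡ fun 𝓑 f (map to as)

  -- The smallest substructure containing a, generated inductively.
  data Cl (𝓜 : Structure L) {k} (a : Vec (Carrier 𝓜) k) : Pred (Carrier 𝓜) 0ℓ where
    gen : ∀ j → Cl 𝓜 a (lookup a j)
    op  : ∀ {m} (f : m ∈ Fun) {bs} → All (Cl 𝓜 a) bs → Cl 𝓜 a (fun 𝓜 f bs)

  module _ (𝓜 : Structure L) {k} (a : Vec (Carrier 𝓜) k) where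
    eval  : Term L k → Carrier 𝓜
    evals : ∀ {n} → Vec (Term L k) n → Vec (Carrier 𝓜) n
    eval (var j)    = lookup a j
    eval (app f ts) = fun 𝓜 f (evals ts)
    evals []        = []
    evals (t ∷ ts)  = eval t ∷ evals ts

  _⊨_[_] : (𝓜 : Structure L) → ∀ {k} → Atomic L k → Vec (Carrier 𝓜) k → Set
  𝓜 ⊨ app r ts [ a ] = rel 𝓜 r (evals 𝓜 a ts)
  𝓜 ⊨ (s ≈ t)   [ a ] = eval 𝓜 a s ≡ eval 𝓜 a t

  SameAtomicType : (𝓐 𝓑 : Structure L) → ∀ {k} → Vec (Carrier 𝓐) k → Vec (Carrier 𝓑) k → Set
  SameAtomicType 𝓐 𝓑 a b = ∀ ψ → 𝓐 ⊨ ψ [ a ] ⇔ 𝓑 ⊨ ψ [ b ]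

  GeneratedBy : (𝓜 : Structure L) → ∀ {k} → Vec (Carrier 𝓜) k → Set
  GeneratedBy 𝓜 a = ∀ x → x ∈ Cl 𝓜 a

  FinitelyGenerated : Structure L → Set
  FinitelyGenerated 𝓜 = ∃[ k ] ∃[ a ] GeneratedBy 𝓜 {k} a

  module _ (𝓜 : ωStructure L) where
    open ωStructure 𝓜 using (dom; structure)

    ωtuple : ∀ {k} → Vec (∃ dom) k → ℕ
    ωtuple a = tuple (map proj₁ a)

    PosDiagram NegDiagram FunDiagram : Pred ℕ 0ℓ
    PosDiagram x = ∃[ n ] ∃[ r ] ∃[ a ] x ≡ ⟨ n , ωtuple a ⟩ × rel structure {n} r a
    NegDiagram x = ∃[ n ] ∃[ r ] ∃[ a ] x ≡ ⟨ n , ωtuple a ⟩ × ¬ rel structure {n} r a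
    FunDiagram x = ∃[ m ] ∃[ f ] ∃[ a ]
      x ≡ ⟨ m , ⟨ ωtuple a , proj₁ (fun structure {m} f a) ⟩ ⟩

  -- A computable structure is given by a decision procedure for its domain
  -- and c.e. indices for the three diagrams.
  record _IndexesComputable_ (e : ℕ) (𝓜 : ωStructure L) : Set where
    field
      d r s f      : ℕ
      components   : e ≡ ⟨ d , ⟨ r , ⟨ s , f ⟩ ⟩ ⟩
      domain       : d Decides ωStructure.dom 𝓜
      relations    : PosDiagram 𝓜 ≐ W r
      nonrelations : NegDiagram 𝓜 ≐ W s
      functions    : FunDiagram 𝓜 ≐ W f

  record IsAge {ℓ} (K : Pred (Structure L) ℓ) : Set (lsuc 0ℓ ⊔ ℓ) where
    field
      closed   : ∀ {𝓐 𝓑} → 𝓐 ≅ 𝓑 → 𝓐 ∈ K → 𝓑 ∈ K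
      finitely : ∀ {𝓐} → 𝓐 ∈ K → FinitelyGenerated 𝓐

  -- 𝓐 i, size i, a i and index i are the data of the unique triple of 𝕂 whose
  -- third entry is i.
  record ComputableAge {ℓ} (K : Pred (Structure L) ℓ) : Set (lsuc 0ℓ ⊔ ℓ) where
    field
      isAge : IsAge K
      𝕂     : Pred ℕ 0ℓ
      𝕂-ce  : CE 𝕂
      𝓐     : ℕ → ωStructure L

    ∣𝓐∣ : ℕ → Structure L
    ∣𝓐∣ i = ωStructure.structure (𝓐 i)

    field
      size  : ℕ → ℕ
      a     : ∀ i → Vec (Carrier (∣𝓐∣ i)) (size i)
      index : ℕ → ℕ

    𝕀 : ℕ → ℕ
    𝕀 i = ⟨ ωtuple (𝓐 i) (a i) , ⟨ index i , i ⟩ ⟩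

    field
      triples    : 𝕂 ≐ λ x → ∃[ i ] x ≡ 𝕀 i
      computable : ∀ i → index i IndexesComputable 𝓐 i
      generated  : ∀ i → GeneratedBy (∣𝓐∣ i) (a i)
      sound      : ∀ i → ∣𝓐∣ i ∈ K
      complete   : ∀ {𝓑} → 𝓑 ∈ K → ∃[ i ] 𝓑 ≅ ∣𝓐∣ i

    EmbeddingInfo : Pred ℕ 0ℓ
    EmbeddingInfo x = ∃[ k₀ ] ∃[ k₁ ] ∃[ n ]
           ∃[ b₀ ] ∃[ b₁ ] SameAtomicType (∣𝓐∣ k₀) (∣𝓐∣ k₁) {n} b₀ b₁ ×
             x ≡ ⟨ 𝕀 k₀ , ⟨ ωtuple (𝓐 k₀) b₀ , ⟨ 𝕀 k₁ , ωtuple (𝓐 k₁) b₁ ⟩ ⟩ ⟩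

FiniteLanguage : Language → Set
FiniteLanguage L = ∃[ ns ] ∀ n → n ∈ Rel ⊎ n ∈ Fun → n List.∈ ns
  where open Language L

-- P has at most m elements, up to ≡.
AtMost : ∀ {A : Set} → ℕ → Pred A 0ℓ → Set
AtMost m P = ∃[ xs ] length xs ≤ m × (∀ {x} → x ∈ P → x List.∈ xs)

UniformlyFinite : ∀ {ℓ} {L : Language} → Pred (Structure L) ℓ → Set (lsuc 0ℓ ⊔ ℓ)
UniformlyFinite {L = L} K =
  FiniteLanguage L ×
  ∃[ f ] ComputableFun f ×
    (∀ {𝓜} → 𝓜 ∈ K → ∀ {k} (a : Vec (Structure.Carrier 𝓜) k) → AtMost (f k) (Cl 𝓜 a))

{-# OPTIONS --safe #-}

-- The complement of the embedding information is Σ₁.  The set of triples is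
-- decidable because a number u with third entry i is a triple exactly if it is
-- the member of 𝕂 with third entry i, and domains are decidable.  For tuples b₀
-- and b₁ of the same length, b₀ ≄ b₁ has a finite witness: the pairs of values
-- of terms at b₀ and b₁ are generated from the entries of b₀ and b₁ by
-- Horn clauses, and b₀ ≄ b₁ as soon as the generated pairs are not the graph of
-- an injection or disagree on a relation, which the c.e. positive and negative
-- diagrams confirm.  Hence one query to 𝟎′ decides membership.
--
-- If the structures are uniformly finite, then b₀ ≃ b₁ has a finite witness as
-- well: a finite list of pairs that contains the pairs of entries, is the graph
-- of an injection, is closed under the finitely many functions and agrees on
-- the finitely many relations.  So membership is also Σ₁, and Post's theorem
-- applies.
--
-- Both parts need that Σ₁ formulas over {(e, x, y) : φ e x y} define c.e. sets.
-- Computations are derivations from Horn clauses over coded facts, and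
-- derivability from Σ₁ clauses is Σ₁, a witness being a list in which every
-- fact follows from later ones.
module Submission where

open import Level using (0ℓ)
open import Axiom.ExcludedMiddle using (ExcludedMiddle)
open import Data.Fin using (Fin; zero; suc; toℕ; _↑ˡ_; _↑ʳ_)
open import Data.List using (List; []; _∷_) renaming (_++_ to _++ˡ_)
open import Data.List.Membership.Propositional using (find; lose) renaming (_∈_ to _∈ˡ_)
open import Data.List.Membership.Propositional.Properties using (∈-++⁺ˡ; ∈-++⁺ʳ)
open import Data.List.Relation.Unary.All as All using (All; []; _∷_)
open import Data.List.Relation.Unary.Any as Any using (Any; here; there)
open import Data.Nat
open import Data.Nat.Properties
open import Data.Product
  using (Σ-syntax; ∃; ∃-syntax; _×_; _,_; proj₁; proj₂; map₂)
open import Data.Sum as Sum using (_⊎_; inj₁; inj₂)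
open import Data.Unit using (⊤; tt)
open import Data.Vec as Vec using (Vec; []; _∷_; _++_; lookup; tabulate) renaming (map to vmap)
open import Data.Vec.Properties using (lookup-map; lookup-++ˡ; lookup-++ʳ; tabulate-cong; tabulate∘lookup)
open import Data.Vec.Relation.Unary.All using () renaming (All to Allᵛ; [] to []ᵛ; _∷_ to _∷ᵛ_)
open import Function using (_∘_; id)
open import Function.Bundles using (_⇔_; mk⇔; Equivalence)
open import Relation.Binary.Definitions using (tri<; tri≈; tri>)
open import Relation.Binary.PropositionalEquality
open import Relation.Nullary using (¬_; Dec; yes; no; contradiction)
open import Relation.Unary using (Pred; _∈_; _∉_; ∅; Irrelevant)
open import Defs
open Equivalence

-- Pairing and codes

-- `next` runs through each antidiagonal in order; at its end the sum of the components grows by one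
-- and `tri` supplies exactly the jump of one.
⟨⟩-next : ∀ p → ⟨ proj₁ (next p) , proj₂ (next p) ⟩ ≡ suc ⟨ proj₁ p , proj₂ p ⟩
⟨⟩-next (zero , y) = trans (+-identityʳ _) (trans (cong (λ n → suc n + tri n) (+-identityʳ y)) (cong suc (+-comm y (tri y))))
⟨⟩-next (suc x , y) rewrite +-suc x y = +-suc _ y

⟨⟩-unpair : ∀ n → ⟨ π₁ n , π₂ n ⟩ ≡ n
⟨⟩-unpair zero    = refl
⟨⟩-unpair (suc n) = trans (⟨⟩-next (unpair n)) (cong suc (⟨⟩-unpair n))

-- Induction on the sum, and for a fixed sum on the second component: under `next`, (x , suc y)
-- comes after (suc x , y), and (suc x , 0) after (0 , x).
unpair-⟨⟩ : ∀ x y → unpair ⟨ x , y ⟩ ≡ (x , y)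
unpair-⟨⟩ x y = go (x + y) x y refl
  where
  go : ∀ s x y → x + y ≡ s → unpair ⟨ x , y ⟩ ≡ (x , y)
  go s       x       (suc y) e = trans (cong unpair (⟨⟩-next (suc x , y)))
                                   (cong next (go s (suc x) y (trans (sym (+-suc x y)) e)))
  go s       zero    zero    e = refl
  go (suc s) (suc x) zero    e = trans (cong unpair (⟨⟩-next (0 , x)))
                                   (cong next (go s 0 x (trans (sym (+-identityʳ x)) (suc-injective e))))

infixr 6 _∙_ _·_

-- The pairing is sealed: unfolded, its arguments could not be inferred by unification.
opaque
  _∙_ : ℕ → ℕ → ℕ
  x ∙ y = ⟨ x , y ⟩

  ∙≡⟨⟩ : ∀ x y → x ∙ y ≡ ⟨ x , y ⟩
  ∙≡⟨⟩ x y = refl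

  π₁-∙ : ∀ x y → π₁ (x ∙ y) ≡ x
  π₁-∙ x y = cong proj₁ (unpair-⟨⟩ x y)

  π₂-∙ : ∀ x y → π₂ (x ∙ y) ≡ y
  π₂-∙ x y = cong proj₂ (unpair-⟨⟩ x y)

  ∙-π : ∀ n → π₁ n ∙ π₂ n ≡ n
  ∙-π = ⟨⟩-unpair

  ∙-≥ʳ : ∀ x y → y ≤ x ∙ y
  ∙-≥ʳ x y = m≤n+m y (tri (x + y))

∙-injective : ∀ {a b c d} → a ∙ b ≡ c ∙ d → a ≡ c × b ≡ d
∙-injective {a} {b} {c} {d} e =
  trans (sym (π₁-∙ a b)) (trans (cong π₁ e) (π₁-∙ c d)) ,
  trans (sym (π₂-∙ a b)) (trans (cong π₂ e) (π₂-∙ c d))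

∙∙≡⟨⟩ : ∀ x y z → x ∙ y ∙ z ≡ ⟨ x , ⟨ y , z ⟩ ⟩
∙∙≡⟨⟩ x y z = trans (∙≡⟨⟩ x (y ∙ z)) (cong ⟨ x ,_⟩ (∙≡⟨⟩ y z))

-- A uniform decomposition of program numbers: injectivity of the pairing splits an equation between
-- numbers into one of constructors and one of arguments.
tag args : Code → ℕ
tag zero       = 0
tag succ       = 1
tag left       = 2
tag right      = 3
tag oracle     = 4
tag (pair _ _) = 5
tag (comp _ _) = 6
tag (prec _ _) = 7
tag (mu _)     = 8
args (pair c d) = ⌜ c ⌝ ∙ ⌜ d ⌝
args (comp c d) = ⌜ c ⌝ ∙ ⌜ d ⌝
args (prec c d) = ⌜ c ⌝ ∙ ⌜ d ⌝
args (mu c)     = ⌜ c ⌝ ∙ 0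
args _          = 0 ∙ 0

opaque
  unfolding _∙_

  ⌜⌝-∙ : ∀ c → ⌜ c ⌝ ≡ tag c ∙ args c
  ⌜⌝-∙ zero       = refl
  ⌜⌝-∙ succ       = refl
  ⌜⌝-∙ left       = refl
  ⌜⌝-∙ right      = refl
  ⌜⌝-∙ oracle     = refl
  ⌜⌝-∙ (pair c d) = refl
  ⌜⌝-∙ (comp c d) = refl
  ⌜⌝-∙ (prec c d) = refl
  ⌜⌝-∙ (mu c)     = refl

-- `Φ` quantifies over the programs with a given number; this makes the number determine the
-- program.
⌜⌝-injective : ∀ c d → ⌜ c ⌝ ≡ ⌜ d ⌝ → c ≡ d
⌜⌝-injective c d e with ∙-injective (trans (sym (⌜⌝-∙ c)) (trans e (⌜⌝-∙ d)))
... | t , a = go c d t a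
  where
  go : ∀ c d → tag c ≡ tag d → args c ≡ args d → c ≡ d
  go zero       zero       refl _ = refl
  go succ       succ       refl _ = refl
  go left       left       refl _ = refl
  go right      right      refl _ = refl
  go oracle     oracle     refl _ = refl
  go (pair c d) (pair c′ d′) refl e with ∙-injective e
  ... | p , q = cong₂ pair (⌜⌝-injective c c′ p) (⌜⌝-injective d d′ q)
  go (comp c d) (comp c′ d′) refl e with ∙-injective e
  ... | p , q = cong₂ comp (⌜⌝-injective c c′ p) (⌜⌝-injective d d′ q)
  go (prec c d) (prec c′ d′) refl e with ∙-injective e
  ... | p , q = cong₂ prec (⌜⌝-injective c c′ p) (⌜⌝-injective d d′ q)
  go (mu c)     (mu c′)      refl e = cong mu (⌜⌝-injective c c′ (proj₁ (∙-injective e)))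

-- Primitive recursive terms

-- In `rec b s k` the term `s` binds the previous value first and the counter second. Substitution
-- is a constructor, so that its value holds by definition.
data Tm (n : ℕ) : Set where
  var     : Fin n → Tm n
  lit     : ℕ → Tm n
  suc     : Tm n → Tm n
  fst snd : Tm n → Tm n
  _·_     : Tm n → Tm n → Tm n
  rec     : Tm n → Tm (2 + n) → Tm n → Tm n
  sub     : ∀ {m} → Tm m → Vec (Tm n) m → Tm n

v₀ : ∀ {n} → Tm (1 + n)
v₀ = var zero
v₁ : ∀ {n} → Tm (2 + n)
v₁ = var (suc zero)
v₂ : ∀ {n} → Tm (3 + n)
v₂ = var (suc (suc zero))
v₃ : ∀ {n} → Tm (4 + n)
v₃ = var (suc (suc (suc zero)))
v₄ : ∀ {n} → Tm (5 + n)
v₄ = var (suc (suc (suc (suc zero))))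
v₅ : ∀ {n} → Tm (6 + n)
v₅ = var (suc (suc (suc (suc (suc zero)))))
v₆ : ∀ {n} → Tm (7 + n)
v₆ = var (suc (suc (suc (suc (suc (suc zero))))))
v₇ : ∀ {n} → Tm (8 + n)
v₇ = var (suc (suc (suc (suc (suc (suc (suc zero)))))))
v₈ : ∀ {n} → Tm (9 + n)
v₈ = var (suc (suc (suc (suc (suc (suc (suc (suc zero))))))))

natrec : {A : Set} → A → (ℕ → A → A) → ℕ → A
natrec b s zero    = b
natrec b s (suc k) = s k (natrec b s k)

val  : ∀ {n} → Tm n → Vec ℕ n → ℕ
vals : ∀ {n m} → Vec (Tm n) m → Vec ℕ n → Vec ℕ m
val (var i)     γ = lookup γ i
val (lit k)     γ = k
val (suc t)     γ = suc (val t γ)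
val (fst t)     γ = π₁ (val t γ)
val (snd t)     γ = π₂ (val t γ)
val (t · u)     γ = val t γ ∙ val u γ
val (rec b s k) γ = natrec (val b γ) (λ i z → val s (z ∷ i ∷ γ)) (val k γ)
val (sub t σ)   γ = val t (vals σ γ)
vals []      γ = []
vals (t ∷ σ) γ = val t γ ∷ vals σ γ

-- Compilation of terms into programs

env : ∀ {n} → Vec ℕ n → ℕ
env []      = 0
env (x ∷ γ) = x ∙ env γ

lookupᶜ : ∀ {n} → Fin n → Code
lookupᶜ zero    = left
lookupᶜ (suc i) = comp (lookupᶜ i) right

constᶜ : ℕ → Code
constᶜ zero    = zero
constᶜ (suc k) = comp succ (constᶜ k)

-- There is no basic identity program; pairing the two projections gives one. `shuffleᶜ` turns the
-- order in which `prec` feeds its step (parameter, counter, value) into the order of an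
-- environment.
idᶜ shuffleᶜ : Code
idᶜ      = pair left right
shuffleᶜ = pair (comp right right) (pair (comp left right) left)

compile  : ∀ {n} → Tm n → Code
compiles : ∀ {n m} → Vec (Tm n) m → Code
compile (var i)     = lookupᶜ i
compile (lit k)     = constᶜ k
compile (suc t)     = comp succ (compile t)
compile (fst t)     = comp left (compile t)
compile (snd t)     = comp right (compile t)
compile (t · u)     = pair (compile t) (compile u)
compile (rec b s k) = comp (prec (compile b) (comp (compile s) shuffleᶜ)) (pair idᶜ (compile k))
compile (sub t σ)   = comp (compile t) (compiles σ)
compiles []      = zero
compiles (t ∷ σ) = pair (compile t) (compiles σ)

-- The semantics is a relation. Uniqueness is carried along for the runs in use, in place of a proof
-- that all programs are deterministic.
record Computes (c : Code) (A : Pred ℕ 0ℓ) (x y : ℕ) : Set where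
  constructor computes
  field
    halts  : ⟦ c ⟧ A x y
    unique : ∀ {z} → ⟦ c ⟧ A x z → z ≡ y
open Computes public

module _ {A : Pred ℕ 0ℓ} where

  private
    infix 4 _∶_↦_
    _∶_↦_ : Code → ℕ → ℕ → Set
    c ∶ x ↦ y = Computes c A x y

  cast : ∀ {c x x′ y y′} → x ≡ x′ → y ≡ y′ → c ∶ x ↦ y → c ∶ x′ ↦ y′
  cast refl refl r = r

  comp-computes : ∀ {c d x y z} → d ∶ x ↦ y → c ∶ y ↦ z → comp c d ∶ x ↦ z
  comp-computes {c} r s = computes (_ , halts r , halts s)
    λ (_ , p , q) → unique s (subst (λ u → ⟦ c ⟧ A u _) (unique r p) q)

  pair-computes : ∀ {c d x y z} → c ∶ x ↦ y → d ∶ x ↦ z → pair c d ∶ x ↦ y ∙ z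
  pair-computes r s = computes (_ , _ , halts r , halts s , ∙≡⟨⟩ _ _)
    λ (_ , _ , p , q , e) → trans (trans e (sym (∙≡⟨⟩ _ _))) (cong₂ _∙_ (unique r p) (unique s q))

  succ-computes : ∀ x → succ ∶ x ↦ suc x
  succ-computes x = computes refl λ e → e

  zero-computes : ∀ x → zero ∶ x ↦ 0
  zero-computes x = computes refl λ e → e

  left-computes : ∀ x y → left ∶ x ∙ y ↦ x
  left-computes x y = cast {left} refl (π₁-∙ x y) (computes refl λ e → e)

  right-computes : ∀ x y → right ∶ x ∙ y ↦ y
  right-computes x y = cast {right} refl (π₂-∙ x y) (computes refl λ e → e)

  constᶜ-computes : ∀ k x → constᶜ k ∶ x ↦ k
  constᶜ-computes zero    x = zero-computes x
  constᶜ-computes (suc k) x = comp-computes (constᶜ-computes k x) (succ-computes k)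

  idᶜ-computes : ∀ x → idᶜ ∶ x ↦ x
  idᶜ-computes x = cast {idᶜ} refl (∙-π x) (pair-computes (computes refl λ e → e) (computes refl λ e → e))

  shuffleᶜ-computes : ∀ x y z → shuffleᶜ ∶ x ∙ y ∙ z ↦ z ∙ y ∙ x
  shuffleᶜ-computes x y z =
    pair-computes (comp-computes (right-computes _ _) (right-computes _ _))
      (pair-computes (comp-computes (right-computes _ _) (left-computes _ _)) (left-computes _ _))

  prec-computes : ∀ {c d x b s} → c ∶ x ↦ b → (∀ i z → d ∶ x ∙ i ∙ z ↦ s i z) →
                  ∀ k → prec c d ∶ x ∙ k ↦ natrec b s k
  prec-computes {c} {d} {x} {b} {s} r r′ k = computes
    (subst₂ (λ u v → Prec (⟦ c ⟧ A) (⟦ d ⟧ A) u v _) (sym (π₁-∙ x k)) (sym (π₂-∙ x k)) (go k))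
    λ p → back k (subst₂ (λ u v → Prec (⟦ c ⟧ A) (⟦ d ⟧ A) u v _) (π₁-∙ x k) (π₂-∙ x k) p)
    where
    go : ∀ k → Prec (⟦ c ⟧ A) (⟦ d ⟧ A) x k (natrec b s k)
    go zero    = halts r
    go (suc k) = _ , go k , subst (λ u → ⟦ d ⟧ A u _) (∙∙≡⟨⟩ x k _) (halts (r′ k _))
    back : ∀ k {y} → Prec (⟦ c ⟧ A) (⟦ d ⟧ A) x k y → y ≡ natrec b s k
    back zero    p = unique r p
    back (suc k) (z , p , q) = unique (r′ k _)
      (subst (λ u → ⟦ d ⟧ A u _) (trans (sym (∙∙≡⟨⟩ x k z)) (cong (λ u → x ∙ k ∙ u) (back k p))) q)

  compile-computes  : ∀ {n} (t : Tm n) γ → compile t ∶ env γ ↦ val t γ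
  compiles-computes : ∀ {n m} (σ : Vec (Tm n) m) γ → compiles σ ∶ env γ ↦ env (vals σ γ)
  compile-computes (var zero)    (x ∷ γ) = left-computes x _
  compile-computes (var (suc i)) (x ∷ γ) = comp-computes (right-computes x _) (compile-computes (var i) γ)
  compile-computes (lit k)     γ = constᶜ-computes k _
  compile-computes (suc t)     γ = comp-computes (compile-computes t γ) (succ-computes _)
  compile-computes (fst t)     γ = comp-computes (compile-computes t γ) (computes refl λ e → e)
  compile-computes (snd t)     γ = comp-computes (compile-computes t γ) (computes refl λ e → e)
  compile-computes (t · u)     γ = pair-computes (compile-computes t γ) (compile-computes u γ)
  compile-computes (rec b s k) γ =
    comp-computes (pair-computes (idᶜ-computes _) (compile-computes k γ))
      (prec-computes (compile-computes b γ)
        (λ i z → comp-computes (shuffleᶜ-computes _ i z) (compile-computes s (z ∷ i ∷ γ))) (val k γ))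
  compile-computes (sub t σ)   γ = comp-computes (compiles-computes σ γ) (compile-computes t (vals σ γ))
  compiles-computes []      γ = zero-computes _
  compiles-computes (t ∷ σ) γ = pair-computes (compile-computes t γ) (compiles-computes σ γ)

-- Σ₁ formulas

weaken : ∀ k {n} → Vec (Tm (k + n)) n
weaken k = tabulate λ i → var (k ↑ʳ i)

vals-vars : ∀ {n m} (f : Fin m → Fin n) γ → vals (tabulate (var ∘ f)) γ ≡ tabulate (lookup γ ∘ f)
vals-vars {m = zero}  f γ = refl
vals-vars {m = suc m} f γ = cong (lookup γ (f zero) ∷_) (vals-vars (f ∘ suc) γ)

vals-weaken : ∀ {k n} (δ : Vec ℕ k) (γ : Vec ℕ n) → vals (weaken k) (δ ++ γ) ≡ γ
vals-weaken {k} δ γ = trans (vals-vars (k ↑ʳ_) (δ ++ γ))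
  (trans (tabulate-cong (lookup-++ʳ δ γ)) (tabulate∘lookup γ))

-- The coding of Defs.tuple; head and tail send 0, the code of the empty list,
-- to 0.
list : List ℕ → ℕ
list []       = 0
list (x ∷ xs) = suc (x ∙ list xs)

list-surjective : ∀ n → ∃ λ xs → list xs ≡ n
list-surjective n = go n n ≤-refl
  where
  go : ∀ b n → n ≤ b → ∃ λ xs → list xs ≡ n
  go b       zero    _        = [] , refl
  go (suc b) (suc n) (s≤s n≤b) =
    let xs , e = go b (π₂ n) (≤-trans (≤-trans (∙-≥ʳ (π₁ n) (π₂ n)) (≤-reflexive (∙-π n))) n≤b)
    in π₁ n ∷ xs , cong suc (trans (cong (π₁ n ∙_) e) (∙-π n))

prev head tail : ℕ → ℕ
prev   = natrec 0 (λ i _ → i)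
head s = π₁ (prev s)
tail s = π₂ (prev s)

drop : ℕ → ℕ → ℕ
drop s = natrec s (λ _ → tail)

drop-∷ : ∀ x s i → drop (suc (x ∙ s)) (suc i) ≡ drop s i
drop-∷ x s zero    = π₂-∙ x s
drop-∷ x s (suc i) = cong tail (drop-∷ x s i)

prevᵗ headᵗ tailᵗ : ∀ {n} → Tm n → Tm n
prevᵗ   = rec (lit 0) v₁
headᵗ s = fst (prevᵗ s)
tailᵗ s = snd (prevᵗ s)

dropᵗ _+ᵗ_ _*ᵗ_ _∸ᵗ_ : ∀ {n} → Tm n → Tm n → Tm n
dropᵗ s = rec s (tailᵗ v₀)
t +ᵗ u  = rec t (suc v₀) u
t *ᵗ u  = rec (lit 0) (v₀ +ᵗ sub t (weaken 2)) u
t ∸ᵗ u  = rec t (prevᵗ v₀) u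

Σᵗ : ∀ {n} → Tm n → Tm (suc n) → Tm n
Σᵗ k t = rec (lit 0) (v₀ +ᵗ sub t (weaken 1)) k

-- Instantiates the witness w and the bound variable i of t : Tm (2 + n), in
-- this order, by the i-th entry of w and i.
nthᵗ : ∀ {n} → Tm (2 + n) → Tm (2 + n)
nthᵗ t = sub t (headᵗ (dropᵗ v₁ v₀) ∷ v₀ ∷ weaken 2)

-- Without negation and unbounded universal quantifiers, every formula is Σ₁ by its syntax.
data Fm (n : ℕ) : Set where
  _≐_ _≭_ : Tm n → Tm n → Fm n
  _∧_ _∨_ : Fm n → Fm n → Fm n
  ∃ᶠ      : Fm (suc n) → Fm n
  ∀<      : Tm n → Fm (suc n) → Fm n
  sub     : ∀ {m} → Fm m → Vec (Tm n) m → Fm n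

infix  5 _≐_ _≭_
infixr 4 _∧_
infixr 3 _∨_

sat : ∀ {n} → Fm n → Vec ℕ n → Set
sat (t ≐ u)   γ = val t γ ≡ val u γ
sat (t ≭ u)   γ = val t γ ≢ val u γ
sat (φ ∧ ψ)   γ = sat φ γ × sat ψ γ
sat (φ ∨ ψ)   γ = sat φ γ ⊎ sat ψ γ
sat (∃ᶠ φ)    γ = ∃[ x ] sat φ (x ∷ γ)
sat (∀< t φ)  γ = ∀ i → i < val t γ → sat φ (i ∷ γ)
sat (sub φ σ) γ = sat φ (vals σ γ)

-- A witness for a bounded universal quantifier is a list of witnesses of its
-- instances.
matrix : ∀ {n} → Fm n → Tm (suc n)
matrix (t ≐ u)   = sub ((t ∸ᵗ u) +ᵗ (u ∸ᵗ t)) (weaken 1)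
matrix (t ≭ u)   = sub (lit 1 ∸ᵗ ((t ∸ᵗ u) +ᵗ (u ∸ᵗ t))) (weaken 1)
matrix (φ ∧ ψ)   = sub (matrix φ) (fst v₀ ∷ weaken 1) +ᵗ sub (matrix ψ) (snd v₀ ∷ weaken 1)
matrix (φ ∨ ψ)   = matrix φ *ᵗ matrix ψ
matrix (∃ᶠ φ)    = sub (matrix φ) (snd v₀ ∷ fst v₀ ∷ weaken 1)
matrix (∀< t φ)  = Σᵗ (sub t (weaken 1)) (nthᵗ (matrix φ))
matrix (sub φ σ) = sub (matrix φ) (v₀ ∷ vmap (λ t → sub t (weaken 1)) σ)

val-+ : ∀ {n} (t u : Tm n) γ → val (t +ᵗ u) γ ≡ val t γ + val u γ
val-+ t u γ = go (val u γ)
  where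
  go : ∀ k → natrec (val t γ) (λ _ → suc) k ≡ val t γ + k
  go zero    = sym (+-identityʳ _)
  go (suc k) = trans (cong suc (go k)) (sym (+-suc _ k))

val-* : ∀ {n} (t u : Tm n) γ → val (t *ᵗ u) γ ≡ val t γ * val u γ
val-* t u γ = trans (go (val u γ)) (*-comm (val u γ) (val t γ))
  where
  go : ∀ k → natrec 0 (λ i z → val (v₀ +ᵗ sub t (weaken 2)) (z ∷ i ∷ γ)) k ≡ k * val t γ
  go zero    = refl
  go (suc k) = trans (val-+ v₀ (sub t (weaken 2)) (_ ∷ k ∷ γ))
    (trans (cong₂ _+_ (go k) (cong (val t) (vals-weaken (_ ∷ k ∷ []) γ))) (+-comm (k * _) _))

val-∸ : ∀ {n} (t u : Tm n) γ → val (t ∸ᵗ u) γ ≡ val t γ ∸ val u γ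
val-∸ t u γ = go (val u γ)
  where
  prev≡pred : ∀ k → prev k ≡ pred k
  prev≡pred zero    = refl
  prev≡pred (suc k) = refl
  go : ∀ k → natrec (val t γ) (λ _ → prev) k ≡ val t γ ∸ k
  go zero    = refl
  go (suc k) = trans (cong prev (go k)) (trans (prev≡pred (val t γ ∸ k)) (pred[m∸n]≡m∸[1+n] (val t γ) k))

val-dist : ∀ {n} (t u : Tm n) γ → val ((t ∸ᵗ u) +ᵗ (u ∸ᵗ t)) γ ≡ (val t γ ∸ val u γ) + (val u γ ∸ val t γ)
val-dist t u γ = trans (val-+ (t ∸ᵗ u) (u ∸ᵗ t) γ) (cong₂ _+_ (val-∸ t u γ) (val-∸ u t γ))

dist≡0 : ∀ m n → (m ∸ n) + (n ∸ m) ≡ 0 → m ≡ n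
dist≡0 m n e = ≤-antisym (m∸n≡0⇒m≤n (m+n≡0⇒m≡0 (m ∸ n) e)) (m∸n≡0⇒m≤n (m+n≡0⇒n≡0 (m ∸ n) e))

0≡dist : ∀ {m n} → m ≡ n → (m ∸ n) + (n ∸ m) ≡ 0
0≡dist {m} refl = cong₂ _+_ (n∸n≡0 m) (n∸n≡0 m)

val-Σ : ∀ {n} (k : Tm n) t γ → val (Σᵗ k t) γ ≡ 0 ⇔ (∀ i → i < val k γ → val t (i ∷ γ) ≡ 0)
val-Σ k t γ = mk⇔ (go (val k γ)) (back (val k γ))
  where
  step : ∀ i z → val (v₀ +ᵗ sub t (weaken 1)) (z ∷ i ∷ γ) ≡ z + val t (i ∷ γ)
  step i z = trans (val-+ v₀ (sub t (weaken 1)) (z ∷ i ∷ γ))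
    (cong (λ δ → z + val t δ) (vals-weaken (z ∷ []) (i ∷ γ)))
  s : ℕ → ℕ
  s = natrec 0 (λ i z → val (v₀ +ᵗ sub t (weaken 1)) (z ∷ i ∷ γ))
  go : ∀ k → s k ≡ 0 → ∀ i → i < k → val t (i ∷ γ) ≡ 0
  go (suc k) e i (s≤s i≤k) with trans (sym (step k (s k))) e | m≤n⇒m<n∨m≡n i≤k
  ... | e′ | inj₁ i<k  = go k (m+n≡0⇒m≡0 (s k) e′) i i<k
  ... | e′ | inj₂ refl = m+n≡0⇒n≡0 (s k) e′
  back : ∀ k → (∀ i → i < k → val t (i ∷ γ) ≡ 0) → s k ≡ 0
  back zero    h = refl
  back (suc k) h = trans (step k (s k))
    (cong₂ _+_ (back k λ i i<k → h i (m<n⇒m<1+n i<k)) (h k (n<1+n k)))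

-- Finite choice: the witnesses of `k` instances are gathered in the code of one list.
collect : ∀ {P : ℕ → ℕ → Set} k → (∀ i → i < k → ∃[ w ] P i w) → ∃[ s ] (∀ i → i < k → P i (head (drop s i)))
collect zero    h = 0 , λ _ ()
collect {P} (suc k) h with h 0 z<s | collect {P ∘ suc} k (λ i i<k → h (suc i) (s<s i<k))
... | w , p | s , q = suc (w ∙ s) , λ where
  zero    _         → subst (P 0) (sym (π₁-∙ w s)) p
  (suc i) (s≤s i<k) → subst (λ u → P (suc i) (head u)) (sym (drop-∷ w s i)) (q i i<k)

vals-weakened : ∀ {n m} (σ : Vec (Tm n) m) w γ → vals (vmap (λ t → sub t (weaken 1)) σ) (w ∷ γ) ≡ vals σ γ
vals-weakened []      w γ = refl
vals-weakened (t ∷ σ) w γ = cong₂ _∷_ (cong (val t) (vals-weaken (w ∷ []) γ)) (vals-weakened σ w γ)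

-- Witnesses are the zeros of the matrix in its first variable. An equation becomes a distance, a
-- conjunction a sum with a pair of witnesses, a disjunction a product with one shared witness.
sat⇒matrix : ∀ {n} (φ : Fm n) γ → sat φ γ → ∃[ w ] val (matrix φ) (w ∷ γ) ≡ 0
matrix⇒sat : ∀ {n} (φ : Fm n) γ w → val (matrix φ) (w ∷ γ) ≡ 0 → sat φ γ

sat⇒matrix (t ≐ u) γ e = 0 , trans (cong (val ((t ∸ᵗ u) +ᵗ (u ∸ᵗ t))) (vals-weaken (0 ∷ []) γ))
  (trans (val-dist t u γ) (0≡dist e))
sat⇒matrix (t ≭ u) γ ne = 0 , trans (cong (val (lit 1 ∸ᵗ ((t ∸ᵗ u) +ᵗ (u ∸ᵗ t)))) (vals-weaken (0 ∷ []) γ))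
  (trans (val-∸ (lit 1) ((t ∸ᵗ u) +ᵗ (u ∸ᵗ t)) γ)
    (m≤n⇒m∸n≡0 (n≢0⇒n>0 λ e → ne (dist≡0 _ _ (trans (sym (val-dist t u γ)) e)))))
sat⇒matrix (φ ∧ ψ) γ (p , q) with sat⇒matrix φ γ p | sat⇒matrix ψ γ q
... | w , e | w′ , e′ = w ∙ w′ ,
  trans (val-+ (sub (matrix φ) (fst v₀ ∷ weaken 1)) (sub (matrix ψ) (snd v₀ ∷ weaken 1)) (w ∙ w′ ∷ γ))
    (cong₂ _+_
      (trans (cong₂ (λ u δ → val (matrix φ) (u ∷ δ)) (π₁-∙ w w′) (vals-weaken (_ ∷ []) γ)) e)
      (trans (cong₂ (λ u δ → val (matrix ψ) (u ∷ δ)) (π₂-∙ w w′) (vals-weaken (_ ∷ []) γ)) e′))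
sat⇒matrix (φ ∨ ψ) γ (inj₁ p) with sat⇒matrix φ γ p
... | w , e = w , trans (val-* (matrix φ) (matrix ψ) (w ∷ γ)) (cong (_* val (matrix ψ) (w ∷ γ)) e)
sat⇒matrix (φ ∨ ψ) γ (inj₂ q) with sat⇒matrix ψ γ q
... | w , e = w , trans (val-* (matrix φ) (matrix ψ) (w ∷ γ))
  (trans (cong (val (matrix φ) (w ∷ γ) *_) e) (*-zeroʳ (val (matrix φ) (w ∷ γ))))
sat⇒matrix (∃ᶠ φ) γ (x , p) with sat⇒matrix φ (x ∷ γ) p
... | w , e = x ∙ w ,
  trans (cong₂ (λ u δ → val (matrix φ) (u ∷ δ)) (π₂-∙ x w) (cong₂ _∷_ (π₁-∙ x w) (vals-weaken (_ ∷ []) γ))) e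
sat⇒matrix (∀< t φ) γ h with collect (val t γ) (λ i i<t → sat⇒matrix φ (i ∷ γ) (h i i<t))
... | w , p = w , from (val-Σ (sub t (weaken 1)) (nthᵗ (matrix φ)) (w ∷ γ)) λ i i<t →
  trans (cong (λ δ → val (matrix φ) (_ ∷ i ∷ δ)) (vals-weaken (i ∷ w ∷ []) γ))
    (p i (subst (i <_) (cong (val t) (vals-weaken (w ∷ []) γ)) i<t))
sat⇒matrix (sub φ σ) γ p with sat⇒matrix φ (vals σ γ) p
... | w , e = w , trans (cong (λ δ → val (matrix φ) (w ∷ δ)) (vals-weakened σ w γ)) e

matrix⇒sat (t ≐ u) γ w e = dist≡0 _ _ (trans (sym (val-dist t u γ))
  (trans (sym (cong (val ((t ∸ᵗ u) +ᵗ (u ∸ᵗ t))) (vals-weaken (w ∷ []) γ))) e))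
matrix⇒sat (t ≭ u) γ w e e′ with trans (sym (val-∸ (lit 1) ((t ∸ᵗ u) +ᵗ (u ∸ᵗ t)) γ))
  (trans (sym (cong (val (lit 1 ∸ᵗ ((t ∸ᵗ u) +ᵗ (u ∸ᵗ t)))) (vals-weaken (w ∷ []) γ))) e)
... | e″ rewrite val-dist t u γ | 0≡dist e′ = contradiction e″ λ ()
matrix⇒sat (φ ∧ ψ) γ w e
  with trans (sym (val-+ (sub (matrix φ) (fst v₀ ∷ weaken 1)) (sub (matrix ψ) (snd v₀ ∷ weaken 1)) (w ∷ γ))) e
... | e′ =
  matrix⇒sat φ γ (π₁ w) (trans (sym (cong (λ δ → val (matrix φ) (π₁ w ∷ δ)) (vals-weaken (w ∷ []) γ))) (m+n≡0⇒m≡0 _ e′)) ,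
  matrix⇒sat ψ γ (π₂ w) (trans (sym (cong (λ δ → val (matrix ψ) (π₂ w ∷ δ)) (vals-weaken (w ∷ []) γ))) (m+n≡0⇒n≡0 _ e′))
matrix⇒sat (φ ∨ ψ) γ w e
  with m*n≡0⇒m≡0∨n≡0 (val (matrix φ) (w ∷ γ)) (trans (sym (val-* (matrix φ) (matrix ψ) (w ∷ γ))) e)
... | inj₁ e′ = inj₁ (matrix⇒sat φ γ w e′)
... | inj₂ e′ = inj₂ (matrix⇒sat ψ γ w e′)
matrix⇒sat (∃ᶠ φ) γ w e = π₁ w , matrix⇒sat φ (π₁ w ∷ γ) (π₂ w)
  (trans (sym (cong (λ δ → val (matrix φ) (π₂ w ∷ π₁ w ∷ δ)) (vals-weaken (w ∷ []) γ))) e)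
matrix⇒sat (∀< t φ) γ w e i i<t = matrix⇒sat φ (i ∷ γ) (head (drop w i))
  (trans (sym (cong (λ δ → val (matrix φ) (_ ∷ i ∷ δ)) (vals-weaken (i ∷ w ∷ []) γ)))
    (to (val-Σ (sub t (weaken 1)) (nthᵗ (matrix φ)) (w ∷ γ)) e i
      (subst (i <_) (sym (cong (val t) (vals-weaken (w ∷ []) γ))) i<t)))
matrix⇒sat (sub φ σ) γ w e = matrix⇒sat φ (vals σ γ) w
  (trans (sym (cong (λ δ → val (matrix φ) (w ∷ δ)) (vals-weakened σ w γ))) e)

-- Decision procedures

least : ∀ (f : ℕ → ℕ) w → f w ≡ 0 → ∃[ v ] f v ≡ 0 × (∀ m → m < v → f m ≢ 0)
least f w e with f 0 ≟ 0
... | yes e₀ = 0 , e₀ , λ _ ()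
least f zero    e | no ne = contradiction e ne
least f (suc w) e | no ne with least (f ∘ suc) w e
... | v , p , q = suc v , p , λ { zero _ → ne ; (suc m) (s≤s m<v) → q m m<v }

-- The output is the least zero of `f`. A smaller output would be a smaller zero, and a larger one
-- would require a nonzero value at the least zero.
mu-computes : ∀ {A c x w} {f : ℕ → ℕ} → (∀ m → Computes c A (x ∙ m) (f m)) → f w ≡ 0 →
              ∃[ v ] f v ≡ 0 × Computes (mu c) A x v
mu-computes {A} {c} {x} {w} {f} r e with least f w e
... | v , p , q = v , p , computes (cast₀ (halts (r v)) p , below) unique′
  where
  cast₀ : ∀ {m y z} → ⟦ c ⟧ A (x ∙ m) y → y ≡ z → ⟦ c ⟧ A ⟨ x , m ⟩ z
  cast₀ {m} {y} h refl = subst (λ u → ⟦ c ⟧ A u y) (∙≡⟨⟩ x m) h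
  value : ∀ {m y} → ⟦ c ⟧ A ⟨ x , m ⟩ y → y ≡ f m
  value {m} {y} h = unique (r m) (subst (λ u → ⟦ c ⟧ A u y) (sym (∙≡⟨⟩ x m)) h)
  below : ∀ m → m < v → ∃[ u ] ⟦ c ⟧ A ⟨ x , m ⟩ (suc u)
  below m m<v = pred (f m) , cast₀ (halts (r m)) (sym (suc-pred (f m) ⦃ ≢-nonZero (q m m<v) ⦄))
  unique′ : ∀ {z} → ⟦ mu c ⟧ A x z → z ≡ v
  unique′ {z} (h , k) with <-cmp z v
  ... | tri< z<v _ _ = contradiction (sym (value h)) (q z z<v)
  ... | tri≈ _ z≡v _ = z≡v
  ... | tri> _ _ v<z = contradiction (trans (value (proj₂ (k v v<z))) p) λ ()

χ-functional : ∀ A {x y z} → χ A x y → χ A x z → y ≡ z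
χ-functional _ (inj₁ (_ , refl)) (inj₁ (_ , refl)) = refl
χ-functional _ (inj₁ (p , _))    (inj₂ (q , _))    = contradiction p q
χ-functional _ (inj₂ (q , _))    (inj₁ (p , _))    = contradiction p q
χ-functional _ (inj₂ (_ , refl)) (inj₂ (_ , refl)) = refl

oracle-computes : ∀ {A x y} → χ A x y → Computes oracle A x y
oracle-computes {A} p = computes p λ q → χ-functional A q p

computes⇒≤T : ∀ {A B} c → (∀ x → ∃[ y ] Computes c A x y × χ B x y) → B ≤T A
computes⇒≤T {A} {B} c r = ⌜ c ⌝ , λ x y → let y′ , run , χy′ = r x in mk⇔
  (λ p → c , refl , subst (⟦ c ⟧ A x) (χ-functional B χy′ p) (halts run))
  λ (d , e , h) → subst (χ B x)
    (sym (unique run (subst (λ d → ⟦ d ⟧ A x y) (⌜⌝-injective d c e) h))) χy′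

-- `mu` passes the candidate after the input, whereas a matrix has the witness as its first
-- variable.
argᶜ : Code
argᶜ = pair right (pair left zero)

argᶜ-computes : ∀ {A} x w → Computes argᶜ A (x ∙ w) (env (w ∷ x ∷ []))
argᶜ-computes x w = pair-computes (right-computes x w) (pair-computes (left-computes x w) (zero-computes _))

searchᶜ : Tm 2 → Code
searchᶜ t = mu (comp (compile t) argᶜ)

searchᶜ-computes : ∀ {A} t x w → val t (w ∷ x ∷ []) ≡ 0 →
                   ∃[ v ] val t (v ∷ x ∷ []) ≡ 0 × Computes (searchᶜ t) A x v
searchᶜ-computes t x w = mu-computes {c = comp (compile t) argᶜ} {w = w}
  λ m → comp-computes (argᶜ-computes x m) (compile-computes t (m ∷ x ∷ []))

-- Search for a number that witnesses `φ` or `ψ`, then test whether it witnesses `φ`. The search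
-- halts since one of the two formulas holds, and a failed test leaves a witness of `ψ`.
post : ∀ {B} (φ ψ : Fm 1) → (∀ x → Dec (x ∈ B)) →
       (∀ x → x ∈ B ⇔ sat φ (x ∷ [])) → (∀ x → x ∉ B ⇔ sat ψ (x ∷ [])) → Computable B
post {B} φ ψ B? φ-def ψ-def = computes⇒≤T c run
  where
  c : Code
  c = comp (compile (lit 1 ∸ᵗ matrix φ)) (comp argᶜ (pair idᶜ (searchᶜ (matrix (φ ∨ ψ)))))
  holds : ∀ x → sat (φ ∨ ψ) (x ∷ [])
  holds x with B? x
  ... | yes p = inj₁ (to (φ-def x) p)
  ... | no np = inj₂ (to (ψ-def x) np)
  module _ {x v} (e : val (matrix (φ ∨ ψ)) (v ∷ x ∷ []) ≡ 0) where
    φ∨ψ : val (matrix φ) (v ∷ x ∷ []) ≡ 0 ⊎ val (matrix ψ) (v ∷ x ∷ []) ≡ 0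
    φ∨ψ = m*n≡0⇒m≡0∨n≡0 _ (trans (sym (val-* (matrix φ) (matrix ψ) (v ∷ x ∷ []))) e)
    decide : ∀ k → val (matrix φ) (v ∷ x ∷ []) ≡ k → χ B x (1 ∸ k)
    decide zero    eq = inj₁ (from (φ-def x) (matrix⇒sat φ (x ∷ []) v eq) , refl)
    decide (suc k) eq with φ∨ψ
    ... | inj₁ e′ = contradiction (trans (sym eq) e′) λ ()
    ... | inj₂ e′ = inj₂ (from (ψ-def x) (matrix⇒sat ψ (x ∷ []) v e′) , 0∸n≡0 k)
    answer : χ B x (val (lit 1 ∸ᵗ matrix φ) (v ∷ x ∷ []))
    answer = subst (χ B x) (sym (val-∸ (lit 1) (matrix φ) (v ∷ x ∷ []))) (decide _ refl)
  run : ∀ x → ∃[ y ] Computes c ∅ x y × χ B x y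
  run x =
    let w , e      = sat⇒matrix (φ ∨ ψ) (x ∷ []) (holds x)
        v , e′ , r = searchᶜ-computes (matrix (φ ∨ ψ)) x w e
    in _ , comp-computes (comp-computes (pair-computes (idᶜ-computes x) r) (argᶜ-computes x v))
             (compile-computes (lit 1 ∸ᵗ matrix φ) (v ∷ x ∷ [])) ,
           answer e′

-- Queries to the halting problem

-- An instance of the s-m-n theorem: the number of the program with constant output is primitive
-- recursive in the constant. The literal 6 is the tag of `comp`.
constᵗ : Tm 1
constᵗ = rec (lit ⌜ zero ⌝) (lit 6 · lit ⌜ succ ⌝ · v₀) v₀

queryᵗ : Code → Tm 1
queryᵗ s = lit 6 · lit ⌜ s ⌝ · constᵗ

constᵗ≡ : ∀ k → val constᵗ (k ∷ []) ≡ ⌜ constᶜ k ⌝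
constᵗ≡ zero    = refl
constᵗ≡ (suc k) = trans (cong (λ u → 6 ∙ ⌜ succ ⌝ ∙ u) (constᵗ≡ k)) (sym (⌜⌝-∙ (comp succ (constᶜ k))))

queryᵗ≡ : ∀ s k → val (queryᵗ s) (k ∷ []) ≡ ⌜ comp s (constᶜ k) ⌝
queryᵗ≡ s k = trans (cong (λ u → 6 ∙ ⌜ s ⌝ ∙ u) (constᵗ≡ k)) (sym (⌜⌝-∙ (comp s (constᶜ k))))

halts-query⇔ : ∀ s x → ⌜ comp s (constᶜ x) ⌝ ∈ 𝟎′ ⇔ (∃[ y ] ⟦ s ⟧ ∅ x y)
halts-query⇔ s x = mk⇔
  (λ (y , d , e , h) → y , query⇒ {⌜ comp s (constᶜ x) ⌝} (subst (λ d → ⟦ d ⟧ ∅ _ y) (⌜⌝-injective d (comp s (constᶜ x)) e) h))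
  (λ (y , h) → y , comp s (constᶜ x) , refl , x , halts (constᶜ-computes x _) , h)
  where
  query⇒ : ∀ {z y} → ⟦ comp s (constᶜ x) ⟧ ∅ z y → ⟦ s ⟧ ∅ x y
  query⇒ {y = y} (u , h , k) = subst (λ u → ⟦ s ⟧ ∅ u y) (unique (constᶜ-computes x _) h) k

-- The program s halts on x if and only if the program that runs s on the
-- constant input x halts on its own code.
co-domain≤T𝟎′ : ExcludedMiddle 0ℓ → ∀ {B} s → (∀ x → x ∉ B ⇔ (∃[ y ] ⟦ s ⟧ ∅ x y)) → B ≤T 𝟎′
co-domain≤T𝟎′ em {B} s s-def = computes⇒≤T c run
  where
  -- A positive answer of the oracle means that `s` halts, hence that `x` is outside `B`; so the
  -- answer is reversed.
  flip : Tm 1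
  flip = lit 1 ∸ᵗ v₀
  c : Code
  c = comp (compile flip) (comp (pair idᶜ zero) (comp oracle (comp (compile (queryᵗ s)) (pair idᶜ zero))))
  1-arg : ∀ {A} x → Computes (pair idᶜ zero) A x (env (x ∷ []))
  1-arg x = pair-computes (idᶜ-computes x) (zero-computes x)
  query⇔ : ∀ x → val (queryᵗ s) (x ∷ []) ∈ 𝟎′ ⇔ (∃[ y ] ⟦ s ⟧ ∅ x y)
  query⇔ x = subst (λ q → q ∈ 𝟎′ ⇔ (∃[ y ] ⟦ s ⟧ ∅ x y)) (sym (queryᵗ≡ s x)) (halts-query⇔ s x)
  ask : ∀ {x y} → χ 𝟎′ (val (queryᵗ s) (x ∷ [])) y → Computes c 𝟎′ x (val flip (y ∷ []))
  ask {x} {y} p =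
    comp-computes
      (comp-computes
        (comp-computes (comp-computes (1-arg x) (compile-computes (queryᵗ s) (x ∷ []))) (oracle-computes p))
        (1-arg y))
      (compile-computes flip (y ∷ []))
  run : ∀ x → ∃[ y ] Computes c 𝟎′ x y × χ B x y
  run x with em {∃[ y ] ⟦ s ⟧ ∅ x y}
  ... | yes p = 0 , ask (inj₁ (from (query⇔ x) p , refl)) , inj₂ (from (s-def x) p , refl)
  ... | no np = 1 , ask (inj₂ (np ∘ to (query⇔ x) , refl)) , inj₁ (in-B , refl)
    where
    in-B : x ∈ B
    in-B with em {x ∈ B}
    ... | yes p  = p
    ... | no x∉B = contradiction (to (s-def x) x∉B) np

-- If the search halts at `v`, its program has computed 0 there, and uniqueness of the output makes
-- this the value of the matrix.
sat⇔search : ∀ φ x → sat φ (x ∷ []) ⇔ (∃[ y ] ⟦ searchᶜ (matrix φ) ⟧ ∅ x y)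
sat⇔search φ x = mk⇔
  (λ p → let w , e = sat⇒matrix φ (x ∷ []) p ; v , _ , r = searchᶜ-computes (matrix φ) x w e in v , halts r)
  (λ (v , h , _) → matrix⇒sat φ (x ∷ []) v (sym (unique
    (comp-computes (arg v) (compile-computes (matrix φ) (v ∷ x ∷ []))) h)))
  where
  arg : ∀ v → Computes argᶜ ∅ ⟨ x , v ⟩ (env (v ∷ x ∷ []))
  arg v = subst (λ u → Computes argᶜ ∅ u (env (v ∷ x ∷ []))) (∙≡⟨⟩ x v) (argᶜ-computes x v)

co-Σ₁⇒≤T𝟎′ : ExcludedMiddle 0ℓ → ∀ {B} (φ : Fm 1) → (∀ x → x ∉ B ⇔ sat φ (x ∷ [])) → B ≤T 𝟎′
co-Σ₁⇒≤T𝟎′ em φ φ-def = co-domain≤T𝟎′ em (searchᶜ (matrix φ))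
  λ x → mk⇔ (to (sat⇔search φ x) ∘ to (φ-def x)) (from (φ-def x) ∘ from (sat⇔search φ x))

-- Horn clauses

⊥ᶠ ⊤ᶠ : ∀ {n} → Fm n
⊥ᶠ = lit 0 ≐ lit 1
⊤ᶠ = lit 0 ≐ lit 0

∃* : ∀ k {n} → Fm (k + n) → Fm n
∃* zero    φ = φ
∃* (suc k) φ = ∃* k (∃ᶠ φ)

sat-∃* : ∀ k {n} (φ : Fm (k + n)) γ → sat (∃* k φ) γ ⇔ (∃[ xs ] sat φ (xs ++ γ))
sat-∃* zero    φ γ = mk⇔ (λ p → [] , p) λ { ([] , p) → p }
sat-∃* (suc k) φ γ = mk⇔
  (λ p → let xs , x , q = to (sat-∃* k (∃ᶠ φ) γ) p in x ∷ xs , q)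
  λ { (x ∷ xs , q) → from (sat-∃* k (∃ᶠ φ) γ) (xs , x , q) }

drop-0 : ∀ i → drop 0 i ≡ 0
drop-0 zero    = refl
drop-0 (suc i) = cong tail (drop-0 i)

-- The first conjunct keeps the position inside the list: past the end `head` yields 0, which would
-- otherwise belong to every list.
memberᶠ : Fm 2
memberᶠ = ∃ᶠ (dropᵗ v₂ v₀ ≭ lit 0 ∧
              headᵗ (dropᵗ v₂ v₀) ≐ var (suc zero))

_∈ᶠ_ : ∀ {n} → Tm n → Tm n → Fm n
t ∈ᶠ s = sub memberᶠ (t ∷ s ∷ [])

sat-member : ∀ {x s} xs → list xs ≡ s → sat memberᶠ (x ∷ s ∷ []) ⇔ x ∈ˡ xs
sat-member {x} xs refl = mk⇔ (λ (i , ne , e) → go xs i ne e) (back xs)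
  where
  go : ∀ xs i → drop (list xs) i ≢ 0 → head (drop (list xs) i) ≡ x → x ∈ˡ xs
  go []       i       ne e = contradiction (drop-0 i) ne
  go (y ∷ ys) zero    ne e = here (trans (sym e) (π₁-∙ y (list ys)))
  go (y ∷ ys) (suc i) ne e = there (go ys i (ne ∘ trans (drop-∷ y (list ys) i))
                                        (trans (cong head (sym (drop-∷ y (list ys) i))) e))
  back : ∀ xs → x ∈ˡ xs → sat memberᶠ (x ∷ list xs ∷ [])
  back (y ∷ ys) (here refl) = 0 , (λ ()) , π₁-∙ y (list ys)
  back (y ∷ ys) (there p)   = let i , ne , e = back ys p in
    suc i , ne ∘ trans (sym (drop-∷ y (list ys) i)) , trans (cong head (drop-∷ y (list ys) i)) e

-- A Horn clause with parameters in n variables, universally quantified over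
-- further variables and restricted by a Σ₁ side condition.
record Clause (n : ℕ) : Set where
  constructor clause
  field
    variables  : ℕ
    conclusion : Tm (variables + n)
    premises   : List (Tm (variables + n))
    side       : Fm (variables + n)
open Clause

-- The conclusion enters through an equation, so that matching on a derivation never has to unify
-- with the value of a term.
data Derivable {n} (cs : List (Clause n)) (γ : Vec ℕ n) (z : ℕ) : Set where
  by : ∀ {c} → c ∈ˡ cs → (xs : Vec ℕ (variables c)) → z ≡ val (conclusion c) (xs ++ γ) →
       sat (side c) (xs ++ γ) → All (λ t → Derivable cs γ (val t (xs ++ γ))) (premises c) →
       Derivable cs γ z

-- Renames past the list variable that `bodyᶠ` places between the variables of a clause and the
-- parameters.
skip : ∀ k {n} → Vec (Tm (k + suc n)) (k + n)
skip k {n} = tabulate (λ i → var (i ↑ˡ suc n)) ++ tabulate λ i → var (k ↑ʳ suc i)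

vals-++ : ∀ {n k m} (σ : Vec (Tm n) k) (τ : Vec (Tm n) m) γ → vals (σ ++ τ) γ ≡ vals σ γ ++ vals τ γ
vals-++ []      τ γ = refl
vals-++ (t ∷ σ) τ γ = cong (val t γ ∷_) (vals-++ σ τ γ)

vals-skip : ∀ {k n} (xs : Vec ℕ k) s (γ : Vec ℕ n) → vals (skip k) (xs ++ s ∷ γ) ≡ xs ++ γ
vals-skip {k} {n} xs s γ = trans
  (vals-++ (tabulate (var ∘ (_↑ˡ suc n))) (tabulate (var ∘ (k ↑ʳ_) ∘ suc)) (xs ++ s ∷ γ)) (cong₂ _++_
  (trans (vals-vars (_↑ˡ suc n) (xs ++ s ∷ γ)) (trans (tabulate-cong (lookup-++ˡ xs (s ∷ γ))) (tabulate∘lookup xs)))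
  (trans (vals-vars ((k ↑ʳ_) ∘ suc) (xs ++ s ∷ γ))
    (trans (tabulate-cong (lookup-++ʳ xs (s ∷ γ) ∘ suc)) (tabulate∘lookup γ))))

premisesᶠ : ∀ {k n} → List (Tm (k + n)) → Fm (k + suc n)
premisesᶠ         []       = ⊤ᶠ
premisesᶠ {k} {n} (t ∷ ts) = sub t (skip k) ∈ᶠ tailᵗ (var (k ↑ʳ zero)) ∧ premisesᶠ {k} {n} ts

-- The first variable outside the clause is a list whose head follows from its
-- tail.
bodyᶠ : ∀ {n} (c : Clause n) → Fm (variables c + suc n)
bodyᶠ (clause k t ts φ) = headᵗ (var (k ↑ʳ zero)) ≐ sub t (skip k) ∧ sub φ (skip k) ∧ premisesᶠ {k} ts

clauseᶠ : ∀ {n} → Clause n → Fm (suc n)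
clauseᶠ c = ∃* (variables c) (bodyᶠ c)

stepᶠ : ∀ {n} → List (Clause n) → Fm (suc n)
stepᶠ []       = ⊥ᶠ
stepᶠ (c ∷ cs) = clauseᶠ c ∨ stepᶠ cs

-- Derivations are lists in which every entry follows from later ones.
opaque
  derivableᶠ : ∀ {n} → List (Clause n) → Fm (suc n)
  derivableᶠ cs = ∃ᶠ (v₀ ≭ lit 0 ∧ headᵗ v₀ ≐ var (suc zero) ∧
    ∀< v₀ (dropᵗ v₁ v₀ ≐ lit 0 ∨
                   sub (stepᶠ cs) (dropᵗ v₁ v₀ ∷ weaken 3)))

module _ {n} (γ : Vec ℕ n) where

  Follows : List ℕ → ℕ → Clause n → Set
  Follows l z (clause k t ts φ) = ∃[ xs ] z ≡ val t (xs ++ γ) × sat φ (xs ++ γ) ×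
                                    All (λ u → val u (xs ++ γ) ∈ˡ l) ts

  Valid : List (Clause n) → List ℕ → Set
  Valid cs []      = ⊤
  Valid cs (z ∷ l) = Any (Follows l z) cs × Valid cs l

  sat-clause : ∀ c z l → sat (clauseᶠ c) (list (z ∷ l) ∷ γ) ⇔ Follows l z c
  sat-clause c@(clause k t ts φ) z l = mk⇔
    (λ p → let xs , e , q , r = to (sat-∃* k (bodyᶠ c) δ) p in
      xs , trans (sym (head≡ xs)) (trans e (cong (val t) (vals-skip xs _ γ))) ,
      subst (sat φ) (vals-skip xs _ γ) q , premises⇒ xs ts r)
    (λ (xs , e , q , r) → from (sat-∃* k (bodyᶠ c) δ)
      (xs , trans (head≡ xs) (trans e (sym (cong (val t) (vals-skip xs _ γ)))) ,
       subst (sat φ) (sym (vals-skip xs _ γ)) q , premises⇐ xs ts r))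
    where
    δ : Vec ℕ (suc n)
    δ = list (z ∷ l) ∷ γ
    s≡ : ∀ xs → lookup (xs ++ δ) (k ↑ʳ zero) ≡ list (z ∷ l)
    s≡ xs = lookup-++ʳ xs δ zero
    head≡ : ∀ xs → head (lookup (xs ++ δ) (k ↑ʳ zero)) ≡ z
    head≡ xs = trans (cong head (s≡ xs)) (π₁-∙ z (list l))
    tail≡ : ∀ xs → list l ≡ tail (lookup (xs ++ δ) (k ↑ʳ zero))
    tail≡ xs = sym (trans (cong tail (s≡ xs)) (π₂-∙ z (list l)))
    premises⇒ : ∀ xs us → sat (premisesᶠ {k} us) (xs ++ δ) → All (λ u → val u (xs ++ γ) ∈ˡ l) us
    premises⇒ xs []       _       = []
    premises⇒ xs (u ∷ us) (p , q) =
      subst (_∈ˡ l) (cong (val u) (vals-skip xs _ γ)) (to (sat-member l (tail≡ xs)) p) ∷ premises⇒ xs us q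
    premises⇐ : ∀ xs us → All (λ u → val u (xs ++ γ) ∈ˡ l) us → sat (premisesᶠ {k} us) (xs ++ δ)
    premises⇐ xs []       []      = refl
    premises⇐ xs (u ∷ us) (p ∷ q) =
      from (sat-member l (tail≡ xs)) (subst (_∈ˡ l) (sym (cong (val u) (vals-skip xs _ γ))) p) , premises⇐ xs us q

  sat-step : ∀ cs z l → sat (stepᶠ cs) (list (z ∷ l) ∷ γ) ⇔ Any (Follows l z) cs
  sat-step cs z l = mk⇔ (go cs) back
    where
    go : ∀ cs → sat (stepᶠ cs) (list (z ∷ l) ∷ γ) → Any (Follows l z) cs
    go (c ∷ cs) (inj₁ p) = here (to (sat-clause c z l) p)
    go (c ∷ cs) (inj₂ p) = there (go cs p)
    back : ∀ {cs} → Any (Follows l z) cs → sat (stepᶠ cs) (list (z ∷ l) ∷ γ)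
    back (here {c} p) = inj₁ (from (sat-clause c z l) p)
    back (there p)    = inj₂ (back p)

  module _ (cs : List (Clause n)) where

    Stepwise : ℕ → ℕ → Set
    Stepwise s i = drop s i ≡ 0 ⊎ sat (stepᶠ cs) (drop s i ∷ γ)

    stepwise-∷ : ∀ z l i → Stepwise (list (z ∷ l)) (suc i) ≡ Stepwise (list l) i
    stepwise-∷ z l i = cong (λ u → u ≡ 0 ⊎ sat (stepᶠ cs) (u ∷ γ)) (drop-∷ z (list l) i)

    valid⇒stepwise : ∀ l → Valid cs l → ∀ i → Stepwise (list l) i
    valid⇒stepwise []      _       i       = inj₁ (drop-0 i)
    valid⇒stepwise (z ∷ l) (p , q) zero    = inj₂ (from (sat-step cs z l) p)
    valid⇒stepwise (z ∷ l) (p , q) (suc i) =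
      subst id (sym (stepwise-∷ z l i)) (valid⇒stepwise l q i)

    -- The bounded hypothesis is inherited by the tail because the code of a list exceeds the code
    -- of its tail.
    stepwise⇒valid : ∀ l → (∀ i → i < list l → Stepwise (list l) i) → Valid cs l
    stepwise⇒valid []      h = tt
    stepwise⇒valid (z ∷ l) h = first (h 0 z<s) , stepwise⇒valid l λ i i<l →
      subst id (stepwise-∷ z l i) (h (suc i) (s<s (<-≤-trans i<l (∙-≥ʳ z (list l)))))
      where
      first : Stepwise (list (z ∷ l)) 0 → Any (Follows l z) cs
      first (inj₂ p) = to (sat-step cs z l) p

    valid⇒derivable : ∀ l → Valid cs l → ∀ {z} → z ∈ˡ l → Derivable cs γ z
    valid⇒derivable (z ∷ l) (p , q) (there z∈l) = valid⇒derivable l q z∈l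
    valid⇒derivable (z ∷ l) (p , q) (here refl) with find p
    ... | c , c∈cs , xs , e , r , s = by c∈cs xs e r (All.map (valid⇒derivable l q) s)

    follows-mono : ∀ {l l′ z} → (∀ {x} → x ∈ˡ l → x ∈ˡ l′) → ∀ c → Follows l z c → Follows l′ z c
    follows-mono h c (xs , e , q , r) = xs , e , q , All.map h r

    valid-++ : ∀ l l′ → Valid cs l → Valid cs l′ → Valid cs (l ++ˡ l′)
    valid-++ []      l′ _       v′ = v′
    valid-++ (z ∷ l) l′ (p , v) v′ = Any.map (λ {c} → follows-mono ∈-++⁺ˡ c) p , valid-++ l l′ v v′

    -- The lists obtained for the premises are concatenated behind the conclusion. Appending keeps a
    -- list valid, since it only adds later entries to draw on.
    derivable⇒valid  : ∀ {z} → Derivable cs γ z → ∃[ l ] Valid cs (z ∷ l)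
    derivables⇒valid : ∀ {k} {xs : Vec ℕ k} {ts} → All (λ t → Derivable cs γ (val t (xs ++ γ))) ts →
                       ∃[ l ] Valid cs l × All (λ t → val t (xs ++ γ) ∈ˡ l) ts
    derivable⇒valid (by c∈cs xs e q ds) with derivables⇒valid ds
    ... | l , v , ms = l , lose c∈cs (xs , e , q , ms) , v
    derivables⇒valid []       = [] , tt , []
    derivables⇒valid (d ∷ ds) with derivable⇒valid d | derivables⇒valid ds
    ... | l , v | l′ , v′ , ms = _ , valid-++ (_ ∷ l) l′ v v′ , here refl ∷ All.map (∈-++⁺ʳ (_ ∷ l)) ms

    opaque
      unfolding derivableᶠ

      sat-derivable : ∀ z → sat (derivableᶠ cs) (z ∷ γ) ⇔ Derivable cs γ z
      sat-derivable z = mk⇔ go back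
        where
        reparam : ∀ {i s} {A : Set} → A ⊎ sat (stepᶠ cs) (drop s i ∷ vals (weaken 3) (i ∷ s ∷ z ∷ γ)) →
                  A ⊎ sat (stepᶠ cs) (drop s i ∷ γ)
        reparam {i} {s} = Sum.map₂ (subst (λ δ → sat (stepᶠ cs) (drop s i ∷ δ)) (vals-weaken (i ∷ s ∷ z ∷ []) γ))
        reparam′ : ∀ {i s} {A : Set} → A ⊎ sat (stepᶠ cs) (drop s i ∷ γ) →
                   A ⊎ sat (stepᶠ cs) (drop s i ∷ vals (weaken 3) (i ∷ s ∷ z ∷ γ))
        reparam′ {i} {s} = Sum.map₂ (subst (λ δ → sat (stepᶠ cs) (drop s i ∷ δ)) (sym (vals-weaken (i ∷ s ∷ z ∷ []) γ)))
        go : sat (derivableᶠ cs) (z ∷ γ) → Derivable cs γ z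
        go (s , ne , e , h) with list-surjective s
        ... | []    , refl = contradiction refl ne
        ... | x ∷ l , refl = valid⇒derivable (x ∷ l) (stepwise⇒valid (x ∷ l) λ i i<s → reparam (h i i<s))
                               (here (trans (sym e) (π₁-∙ x (list l))))
        back : Derivable cs γ z → sat (derivableᶠ cs) (z ∷ γ)
        back d with derivable⇒valid d
        ... | l , v = list (z ∷ l) , (λ ()) , π₁-∙ z (list l) , λ i _ → reparam′ (valid⇒stepwise (z ∷ l) v i)

-- The universal program

-- 0 · e says that e codes a program, 1 · e · x · y that the program coded by e
-- halts on x with output y, and 2 · e · x · m that it halts on the pairs of x
-- with each number below m with nonzero output.
isCodeᵗ : ∀ {n} → Tm n → Tm n
isCodeᵗ e = lit 0 · e

yieldsᵗ nonzeroᵗ : ∀ {n} → Tm n → Tm n → Tm n → Tm n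
yieldsᵗ  e x y = lit 1 · e · x · y
nonzeroᵗ e x m = lit 2 · e · x · m

leafᵗ : ∀ {n} → ℕ → Tm n
leafᵗ k = lit k · lit 0 · lit 0

machine : List (Clause 0)
machine =
  clause 0 (isCodeᵗ (leafᵗ 0)) [] ⊤ᶠ ∷
  clause 0 (isCodeᵗ (leafᵗ 1)) [] ⊤ᶠ ∷
  clause 0 (isCodeᵗ (leafᵗ 2)) [] ⊤ᶠ ∷
  clause 0 (isCodeᵗ (leafᵗ 3)) [] ⊤ᶠ ∷
  clause 0 (isCodeᵗ (leafᵗ 4)) [] ⊤ᶠ ∷
  clause 2 (isCodeᵗ (lit 5 · v₀ · v₁)) (isCodeᵗ v₀ ∷ isCodeᵗ v₁ ∷ []) ⊤ᶠ ∷
  clause 2 (isCodeᵗ (lit 6 · v₀ · v₁)) (isCodeᵗ v₀ ∷ isCodeᵗ v₁ ∷ []) ⊤ᶠ ∷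
  clause 2 (isCodeᵗ (lit 7 · v₀ · v₁)) (isCodeᵗ v₀ ∷ isCodeᵗ v₁ ∷ []) ⊤ᶠ ∷
  clause 1 (isCodeᵗ (lit 8 · v₀ · lit 0)) (isCodeᵗ v₀ ∷ []) ⊤ᶠ ∷
  clause 1 (yieldsᵗ (leafᵗ 0) v₀ (lit 0)) [] ⊤ᶠ ∷
  clause 1 (yieldsᵗ (leafᵗ 1) v₀ (suc v₀)) [] ⊤ᶠ ∷
  clause 1 (yieldsᵗ (leafᵗ 2) v₀ (fst v₀)) [] ⊤ᶠ ∷
  clause 1 (yieldsᵗ (leafᵗ 3) v₀ (snd v₀)) [] ⊤ᶠ ∷
  clause 1 (yieldsᵗ (leafᵗ 4) v₀ (lit 0)) [] ⊤ᶠ ∷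
  clause 5 (yieldsᵗ (lit 5 · v₀ · v₁) v₂ (v₃ · v₄)) (yieldsᵗ v₀ v₂ v₃ ∷ yieldsᵗ v₁ v₂ v₄ ∷ []) ⊤ᶠ ∷
  clause 5 (yieldsᵗ (lit 6 · v₀ · v₁) v₂ v₄) (yieldsᵗ v₁ v₂ v₃ ∷ yieldsᵗ v₀ v₃ v₄ ∷ []) ⊤ᶠ ∷
  -- With zero rounds the step program never runs, so its being a program has to be a premise of its
  -- own.
  clause 4 (yieldsᵗ (lit 7 · v₀ · v₁) (v₂ · lit 0) v₃) (isCodeᵗ v₁ ∷ yieldsᵗ v₀ v₂ v₃ ∷ []) ⊤ᶠ ∷
  clause 6 (yieldsᵗ (lit 7 · v₀ · v₁) (v₂ · suc v₃) v₅)
    (yieldsᵗ (lit 7 · v₀ · v₁) (v₂ · v₃) v₄ ∷ yieldsᵗ v₁ (v₂ · v₃ · v₄) v₅ ∷ []) ⊤ᶠ ∷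
  clause 3 (yieldsᵗ (lit 8 · v₀ · lit 0) v₁ v₂) (yieldsᵗ v₀ (v₁ · v₂) (lit 0) ∷ nonzeroᵗ v₀ v₁ v₂ ∷ []) ⊤ᶠ ∷
  clause 2 (nonzeroᵗ v₀ v₁ (lit 0)) [] ⊤ᶠ ∷
  clause 4 (nonzeroᵗ v₀ v₁ (suc v₂)) (nonzeroᵗ v₀ v₁ v₂ ∷ yieldsᵗ v₀ (v₁ · v₂) (suc v₃) ∷ []) ⊤ᶠ ∷
  []

pattern c0 = here refl
pattern c1 = there c0
pattern c2 = there c1
pattern c3 = there c2
pattern c4 = there c3
pattern c5 = there c4
pattern c6 = there c5
pattern c7 = there c6
pattern c8 = there c7
pattern c9 = there c8
pattern c10 = there c9
pattern c11 = there c10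
pattern c12 = there c11
pattern c13 = there c12
pattern c14 = there c13
pattern c15 = there c14
pattern c16 = there c15
pattern c17 = there c16
pattern c18 = there c17
pattern c19 = there c18
pattern c20 = there c19

-- Correctness of the universal program

Runs : ℕ → Set
Runs = Derivable machine []

code-runs : ∀ c → Runs (0 ∙ ⌜ c ⌝)
code-runs c = subst (Runs ∘ (0 ∙_)) (sym (⌜⌝-∙ c)) (go c)
  where
  go : ∀ c → Runs (0 ∙ tag c ∙ args c)
  go zero       = by c0 [] refl refl []
  go succ       = by c1 [] refl refl []
  go left       = by c2 [] refl refl []
  go right      = by c3 [] refl refl []
  go oracle     = by c4 [] refl refl []
  go (pair c d) = by c5 (_ ∷ _ ∷ []) refl refl (code-runs c ∷ code-runs d ∷ [])
  go (comp c d) = by c6 (_ ∷ _ ∷ []) refl refl (code-runs c ∷ code-runs d ∷ [])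
  go (prec c d) = by c7 (_ ∷ _ ∷ []) refl refl (code-runs c ∷ code-runs d ∷ [])
  go (mu c)     = by c8 (_ ∷ []) refl refl (code-runs c ∷ [])

yields-runs : ∀ c {x y} → ⟦ c ⟧ ∅ x y → Runs (1 ∙ ⌜ c ⌝ ∙ x ∙ y)
yields-runs c {x} {y} h = subst (λ e → Runs (1 ∙ e ∙ x ∙ y)) (sym (⌜⌝-∙ c)) (go c h)
  where
  go : ∀ c {x y} → ⟦ c ⟧ ∅ x y → Runs (1 ∙ (tag c ∙ args c) ∙ x ∙ y)
  go zero       refl = by c9 (_ ∷ []) refl refl []
  go succ       refl = by c10 (_ ∷ []) refl refl []
  go left       refl = by c11 (_ ∷ []) refl refl []
  go right      refl = by c12 (_ ∷ []) refl refl []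
  go oracle     (inj₂ (_ , refl)) = by c13 (_ ∷ []) refl refl []
  go (pair c d) {x} (u , v , h , k , refl) =
    subst (λ y → Runs (1 ∙ (5 ∙ ⌜ c ⌝ ∙ ⌜ d ⌝) ∙ x ∙ y)) (∙≡⟨⟩ u v)
      (by c14 (_ ∷ _ ∷ _ ∷ _ ∷ _ ∷ []) refl refl (yields-runs c h ∷ yields-runs d k ∷ []))
  go (comp c d) (z , h , k) =
    by c15 (_ ∷ _ ∷ _ ∷ _ ∷ _ ∷ []) refl refl (yields-runs d h ∷ yields-runs c k ∷ [])
  go (prec c d) {x} {y} h =
    subst (λ x → Runs (1 ∙ (7 ∙ ⌜ c ⌝ ∙ ⌜ d ⌝) ∙ x ∙ y)) (∙-π x) (loop (π₂ x) h)
    where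
    loop : ∀ n {a y} → Prec (⟦ c ⟧ ∅) (⟦ d ⟧ ∅) a n y → Runs (1 ∙ (7 ∙ ⌜ c ⌝ ∙ ⌜ d ⌝) ∙ (a ∙ n) ∙ y)
    loop zero    h = by c16 (_ ∷ _ ∷ _ ∷ _ ∷ []) refl refl (code-runs d ∷ yields-runs c h ∷ [])
    loop (suc n) {a} {y} (z , h , k) = by c17 (_ ∷ _ ∷ _ ∷ _ ∷ _ ∷ _ ∷ []) refl refl
      (loop n h ∷ subst (λ x → Runs (1 ∙ ⌜ d ⌝ ∙ x ∙ y)) (sym (∙∙≡⟨⟩ a n z)) (yields-runs d k) ∷ [])
  go (mu c) {x} {y} (h , k) = by c18 (_ ∷ _ ∷ _ ∷ []) refl refl
    (subst (λ x → Runs (1 ∙ ⌜ c ⌝ ∙ x ∙ 0)) (sym (∙≡⟨⟩ x y)) (yields-runs c h) ∷ loop y k ∷ [])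
    where
    loop : ∀ n → (∀ m → m < n → ∃[ v ] ⟦ c ⟧ ∅ ⟨ x , m ⟩ (suc v)) → Runs (2 ∙ ⌜ c ⌝ ∙ x ∙ n)
    loop zero    k = by c19 (_ ∷ _ ∷ []) refl refl []
    loop (suc n) k = let v , h = k n (n<1+n n) in by c20 (_ ∷ _ ∷ _ ∷ _ ∷ []) refl refl
      (loop n (λ m m<n → k m (m<n⇒m<1+n m<n)) ∷
       subst (λ x → Runs (1 ∙ ⌜ c ⌝ ∙ x ∙ suc v)) (sym (∙≡⟨⟩ x n)) (yields-runs c h) ∷ [])

IsCode : ℕ → Set
IsCode e = ∃[ c ] ⌜ c ⌝ ≡ e

Nonzero : ℕ → ℕ → ℕ → Set
Nonzero e x n = ∀ m → m < n → ∃[ v ] φ e ⟨ x , m ⟩ (suc v)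

-- The intended reading of a fact by its tag; numbers with a tag above 2 carry no claim.
Meaning : ℕ → ℕ → Set
Meaning 0 z = IsCode z
Meaning 1 z = φ (π₁ z) (π₁ (π₂ z)) (π₂ (π₂ z))
Meaning 2 z = Nonzero (π₁ z) (π₁ (π₂ z)) (π₂ (π₂ z))
Meaning _ z = ⊤

meaning : ∀ {z} k t → k ∙ t ≡ z → Meaning k t → Meaning (π₁ z) (π₂ z)
meaning k t refl = subst₂ Meaning (sym (π₁-∙ k t)) (sym (π₂-∙ k t))

unmeaning : ∀ k t → Meaning (π₁ (k ∙ t)) (π₂ (k ∙ t)) → Meaning k t
unmeaning k t = subst₂ Meaning (π₁-∙ k t) (π₂-∙ k t)

triple≡ : ∀ (P : ℕ → ℕ → ℕ → Set) e x y →
          P (π₁ (e ∙ x ∙ y)) (π₁ (π₂ (e ∙ x ∙ y))) (π₂ (π₂ (e ∙ x ∙ y))) ≡ P e x y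
triple≡ P e x y rewrite π₁-∙ e (x ∙ y) | π₂-∙ e (x ∙ y) | π₁-∙ x y | π₂-∙ x y = refl

prec-at : ∀ {A c d} a n {y} → ⟦ prec c d ⟧ A (a ∙ n) y ≡ Prec (⟦ c ⟧ A) (⟦ d ⟧ A) a n y
prec-at {A} {c} {d} a n = cong₂ (λ u v → Prec (⟦ c ⟧ A) (⟦ d ⟧ A) u v _) (π₁-∙ a n) (π₂-∙ a n)

-- The clause for a further round of a recursion has an earlier stage of the same program as
-- premise; from its number alone the two component programs must be recovered.
prec-inverse : ∀ c {e₁ e₂} → ⌜ c ⌝ ≡ 7 ∙ e₁ ∙ e₂ → ∃[ c₁ ] ∃[ c₂ ] c ≡ prec c₁ c₂ × ⌜ c₁ ⌝ ≡ e₁ × ⌜ c₂ ⌝ ≡ e₂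
prec-inverse c e with ∙-injective (trans (sym (⌜⌝-∙ c)) e)
... | t , a = go c t a
  where
  go : ∀ c {e₁ e₂} → tag c ≡ 7 → args c ≡ e₁ ∙ e₂ → ∃[ c₁ ] ∃[ c₂ ] c ≡ prec c₁ c₂ × ⌜ c₁ ⌝ ≡ e₁ × ⌜ c₂ ⌝ ≡ e₂
  go (prec c d) refl a = c , d , refl , ∙-injective a

-- Soundness by induction on derivations, stated for arbitrary numbers. The other three read the
-- result at a known tag and serve for the premises.
runs⇒meaning : ∀ {z} → Runs z → Meaning (π₁ z) (π₂ z)
runs⇒code    : ∀ {e} → Runs (0 ∙ e) → IsCode e
runs⇒yields  : ∀ {e x y} → Runs (1 ∙ e ∙ x ∙ y) → φ e x y
runs⇒nonzero : ∀ {e x m} → Runs (2 ∙ e ∙ x ∙ m) → Nonzero e x m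

runs⇒code d = unmeaning 0 _ (runs⇒meaning d)
runs⇒yields {e} {x} {y} d = subst id (triple≡ φ e x y) (unmeaning 1 _ (runs⇒meaning d))
runs⇒nonzero {e} {x} {m} d = subst id (triple≡ Nonzero e x m) (unmeaning 2 _ (runs⇒meaning d))

code-meaning : ∀ c → Meaning (π₁ (0 ∙ tag c ∙ args c)) (π₂ (0 ∙ tag c ∙ args c))
code-meaning c = meaning 0 (tag c ∙ args c) refl (c , ⌜⌝-∙ c)

yields-meaning : ∀ c {x y} → ⟦ c ⟧ ∅ x y →
                 Meaning (π₁ (1 ∙ (tag c ∙ args c) ∙ x ∙ y)) (π₂ (1 ∙ (tag c ∙ args c) ∙ x ∙ y))
yields-meaning c {x} {y} h = meaning 1 ((tag c ∙ args c) ∙ x ∙ y) refl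
  (subst id (sym (triple≡ φ (tag c ∙ args c) x y)) (c , ⌜⌝-∙ c , h))

nonzero-meaning : ∀ e x n → Nonzero e x n → Meaning (π₁ (2 ∙ e ∙ x ∙ n)) (π₂ (2 ∙ e ∙ x ∙ n))
nonzero-meaning e x n h = meaning 2 (e ∙ x ∙ n) refl (subst id (sym (triple≡ Nonzero e x n)) h)

runs⇒meaning (by c0 [] refl _ []) = code-meaning zero
runs⇒meaning (by c1 [] refl _ []) = code-meaning succ
runs⇒meaning (by c2 [] refl _ []) = code-meaning left
runs⇒meaning (by c3 [] refl _ []) = code-meaning right
runs⇒meaning (by c4 [] refl _ []) = code-meaning oracle
runs⇒meaning (by c5 (_ ∷ _ ∷ []) refl _ (p ∷ q ∷ [])) with runs⇒code p | runs⇒code q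
... | c , refl | d , refl = code-meaning (pair c d)
runs⇒meaning (by c6 (_ ∷ _ ∷ []) refl _ (p ∷ q ∷ [])) with runs⇒code p | runs⇒code q
... | c , refl | d , refl = code-meaning (comp c d)
runs⇒meaning (by c7 (_ ∷ _ ∷ []) refl _ (p ∷ q ∷ [])) with runs⇒code p | runs⇒code q
... | c , refl | d , refl = code-meaning (prec c d)
runs⇒meaning (by c8 (_ ∷ []) refl _ (p ∷ [])) with runs⇒code p
... | c , refl = code-meaning (mu c)
runs⇒meaning (by c9  (x ∷ []) refl _ []) = yields-meaning zero {x} refl
runs⇒meaning (by c10 (x ∷ []) refl _ []) = yields-meaning succ {x} refl
runs⇒meaning (by c11 (x ∷ []) refl _ []) = yields-meaning left {x} refl
runs⇒meaning (by c12 (x ∷ []) refl _ []) = yields-meaning right {x} refl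
runs⇒meaning (by c13 (x ∷ []) refl _ []) = yields-meaning oracle {x} (inj₂ ((λ ()) , refl))
runs⇒meaning (by c14 (_ ∷ _ ∷ x ∷ u ∷ v ∷ []) refl _ (p ∷ q ∷ [])) with runs⇒yields p | runs⇒yields q
... | c , refl , h | d , refl , k = yields-meaning (pair c d) (u , v , h , k , ∙≡⟨⟩ u v)
runs⇒meaning (by c15 (_ ∷ _ ∷ x ∷ z ∷ y ∷ []) refl _ (p ∷ q ∷ [])) with runs⇒yields p | runs⇒yields q
... | d , refl , h | c , refl , k = yields-meaning (comp c d) (z , h , k)
runs⇒meaning (by c16 (_ ∷ _ ∷ a ∷ y ∷ []) refl _ (p ∷ q ∷ [])) with runs⇒code p | runs⇒yields q
... | d , refl | c , refl , h =
  yields-meaning (prec c d) (subst id (sym (prec-at {c = c} {d} a 0)) h)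
runs⇒meaning (by c17 (_ ∷ _ ∷ a ∷ n ∷ z ∷ y ∷ []) refl _ (p ∷ q ∷ [])) with runs⇒yields p | runs⇒yields q
... | b , b≡ , h | d , d≡ , k with prec-inverse b b≡
-- The program run in this round and the step program of the recursion have the same number, hence
-- are equal.
... | c , d′ , refl , refl , refl with ⌜⌝-injective d d′ d≡
... | refl = yields-meaning (prec c d) (subst id (sym (prec-at {c = c} {d} a (suc n)))
  (z , subst id (prec-at {c = c} {d} a n) h , subst (λ x → ⟦ d ⟧ ∅ x y) (∙∙≡⟨⟩ a n z) k))
runs⇒meaning (by c18 (_ ∷ x ∷ y ∷ []) refl _ (p ∷ q ∷ [])) with runs⇒yields p | runs⇒nonzero q
... | c , refl , h | k = yields-meaning (mu c) (subst (λ x → ⟦ c ⟧ ∅ x 0) (∙≡⟨⟩ x y) h , below)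
  where
  below : ∀ m → m < y → ∃[ v ] ⟦ c ⟧ ∅ ⟨ x , m ⟩ (suc v)
  below m m<y with k m m<y
  ... | v , d , d≡ , h with ⌜⌝-injective d c d≡
  ... | refl = v , h
runs⇒meaning (by c19 (e ∷ x ∷ []) refl _ []) = nonzero-meaning e x 0 λ _ ()
runs⇒meaning (by c20 (e ∷ x ∷ n ∷ v ∷ []) refl _ (p ∷ q ∷ [])) = nonzero-meaning e x (suc n) below
  where
  below : Nonzero e x (suc n)
  below m (s≤s m≤n) with m≤n⇒m<n∨m≡n m≤n
  ... | inj₁ m<n  = runs⇒nonzero p m m<n
  ... | inj₂ refl = v , subst (λ x → φ e x (suc v)) (∙≡⟨⟩ x m) (runs⇒yields q)

-- Sealed, so that formulas built from these two are not unfolded down to the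
-- clauses of the machine.
opaque
  φᶠ : Fm 3
  φᶠ = sub (derivableᶠ machine) (yieldsᵗ v₀ v₁ v₂ ∷ [])

  sat-φ : ∀ e x y → sat φᶠ (e ∷ x ∷ y ∷ []) ⇔ φ e x y
  sat-φ e x y = mk⇔ (runs⇒yields ∘ to (sat-derivable [] machine _))
    λ { (c , refl , h) → from (sat-derivable [] machine _) (yields-runs c h) }

  Wᶠ : Fm 2
  Wᶠ = ∃ᶠ (sub φᶠ (v₁ ∷ v₂ ∷ v₀ ∷ []))

  sat-W : ∀ e x → sat Wᶠ (e ∷ x ∷ []) ⇔ x ∈ W e
  sat-W e x = mk⇔ (map₂ (to (sat-φ _ _ _))) (map₂ (from (sat-φ _ _ _)))

_∈W_ : ∀ {n} → Tm n → Tm n → Fm n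
t ∈W e = sub Wᶠ (e ∷ t ∷ [])

-- Tuples and diagrams

derives : ∀ k {n} → List (Clause n) → Tm (k + n) → Fm (k + n)
derives k cs t = sub (derivableᶠ cs) (t ∷ weaken k)

sat-derives : ∀ {k n} cs t (δ : Vec ℕ k) (γ : Vec ℕ n) →
              sat (derives k cs t) (δ ++ γ) ⇔ Derivable cs γ (val t (δ ++ γ))
sat-derives cs t δ γ = subst (λ γ′ → sat (derivableᶠ cs) (val t (δ ++ γ) ∷ γ′) ⇔ Derivable cs γ (val t (δ ++ γ)))
  (sym (vals-weaken δ γ)) (sat-derivable γ cs (val t (δ ++ γ)))

tuple-∷ : ∀ {n} x (xs : Vec ℕ n) → tuple (x ∷ xs) ≡ suc (x ∙ tuple xs)
tuple-∷ x xs = cong suc (sym (∙≡⟨⟩ x (tuple xs)))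

-- Used to read off that a tuple occurring in a diagram has the length given by the arity of its
-- symbol.
tuple-length : ∀ {m n} (xs : Vec ℕ m) (ys : Vec ℕ n) → tuple xs ≡ tuple ys → m ≡ n
tuple-length []       []       e = refl
tuple-length (x ∷ xs) (y ∷ ys) e = cong suc (tuple-length xs ys (proj₂ (∙-injective
  (suc-injective (trans (sym (tuple-∷ x xs)) (trans e (tuple-∷ y ys)))))))

tuple-injective : ∀ {n} (xs ys : Vec ℕ n) → tuple xs ≡ tuple ys → xs ≡ ys
tuple-injective []       []       e = refl
tuple-injective (x ∷ xs) (y ∷ ys) e
  with p , q ← ∙-injective (suc-injective (trans (sym (tuple-∷ x xs)) (trans e (tuple-∷ y ys))))
  = cong₂ _∷_ p (tuple-injective xs ys q)

drop-tuple : ∀ {n} x (xs : Vec ℕ n) j → drop (tuple (x ∷ xs)) (suc j) ≡ drop (tuple xs) j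
drop-tuple x xs j = trans (cong (λ s → drop s (suc j)) (tuple-∷ x xs)) (drop-∷ x (tuple xs) j)

head-tuple : ∀ {n} x (xs : Vec ℕ n) → head (tuple (x ∷ xs)) ≡ x
head-tuple x xs = trans (cong head (tuple-∷ x xs)) (π₁-∙ x (tuple xs))

nth-tuple : ∀ {n} (xs : Vec ℕ n) i → head (drop (tuple xs) (toℕ i)) ≡ lookup xs i
nth-tuple (x ∷ xs) zero    = head-tuple x xs
nth-tuple (x ∷ xs) (suc i) = trans (cong head (drop-tuple x xs (toℕ i))) (nth-tuple xs i)

drop-tuple≢0 : ∀ {n} (xs : Vec ℕ n) (i : Fin n) → drop (tuple xs) (toℕ i) ≢ 0
drop-tuple≢0 (x ∷ xs) zero    ()
drop-tuple≢0 (x ∷ xs) (suc i) e = drop-tuple≢0 xs i (trans (sym (drop-tuple x xs (toℕ i))) e)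

-- The code of a tuple can therefore bound a quantifier over its positions, as in `baseᶠ`.
index<tuple : ∀ {n} (xs : Vec ℕ n) (i : Fin n) → toℕ i < tuple xs
index<tuple (x ∷ xs) zero    = z<s
index<tuple (x ∷ xs) (suc i) = subst (suc (toℕ i) <_) (sym (tuple-∷ x xs))
  (s<s (<-≤-trans (index<tuple xs i) (∙-≥ʳ x (tuple xs))))

drop-tuple-index : ∀ {n} (xs : Vec ℕ n) j → drop (tuple xs) j ≢ 0 → ∃[ i ] toℕ {n} i ≡ j
drop-tuple-index []       j       ne = contradiction (drop-0 j) ne
drop-tuple-index (x ∷ xs) zero    ne = zero , refl
drop-tuple-index (x ∷ xs) (suc j) ne with drop-tuple-index xs j (ne ∘ trans (drop-tuple x xs j))
... | i , refl = suc i , refl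

module _ {P : Pred ℕ 0ℓ} (irr : Irrelevant P) where

  ∃-≡ : {x y : ∃ P} → proj₁ x ≡ proj₁ y → x ≡ y
  ∃-≡ {x , p} {.x , q} refl = cong (x ,_) (irr p q)

  map-proj₁-injective : ∀ {n} (xs ys : Vec (∃ P) n) → vmap proj₁ xs ≡ vmap proj₁ ys → xs ≡ ys
  map-proj₁-injective []       []       e = refl
  map-proj₁-injective (x ∷ xs) (y ∷ ys) e =
    cong₂ _∷_ (∃-≡ (cong Vec.head e)) (map-proj₁-injective xs ys (cong Vec.tail e))

domainᵗ relationsᵗ nonrelationsᵗ functionsᵗ : ∀ {n} → Tm n → Tm n
domainᵗ       e = fst e
relationsᵗ    e = fst (snd e)
nonrelationsᵗ e = fst (snd (snd e))
functionsᵗ    e = snd (snd (snd e))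

domainⁱ relationsⁱ nonrelationsⁱ functionsⁱ : ℕ → ℕ
domainⁱ       e = π₁ e
relationsⁱ    e = π₁ (π₂ e)
nonrelationsⁱ e = π₁ (π₂ (π₂ e))
functionsⁱ    e = π₂ (π₂ (π₂ e))

module Diagrams {L : Language} (𝓐 : ωStructure L) {e} (I : e IndexesComputable 𝓐) where
  open Language L
  open ωStructure 𝓐
  open Structure structure using (rel; fun)

  private
    module I = _IndexesComputable_ I
    components : e ≡ I.d ∙ I.r ∙ I.s ∙ I.f
    components = trans I.components (sym (trans (∙≡⟨⟩ _ _) (cong ⟨ I.d ,_⟩ (∙∙≡⟨⟩ I.r I.s I.f))))
    snd-e : π₂ e ≡ I.r ∙ I.s ∙ I.f
    snd-e = trans (cong π₂ components) (π₂-∙ I.d _)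
    snd-snd-e : π₂ (π₂ e) ≡ I.s ∙ I.f
    snd-snd-e = trans (cong π₂ snd-e) (π₂-∙ I.r _)
    d≡ : domainⁱ e ≡ I.d
    d≡ = trans (cong π₁ components) (π₁-∙ I.d _)
    r≡ : relationsⁱ e ≡ I.r
    r≡ = trans (cong π₁ snd-e) (π₁-∙ I.r _)
    s≡ : nonrelationsⁱ e ≡ I.s
    s≡ = trans (cong π₁ snd-snd-e) (π₁-∙ I.s _)
    f≡ : functionsⁱ e ≡ I.f
    f≡ = trans (cong π₂ snd-snd-e) (π₂-∙ I.s _)

  domain : domainⁱ e Decides dom
  domain = subst (_Decides dom) (sym d≡) I.domain

  rel∈W : ∀ {n} (r : n ∈ Rel) as → rel r as → n ∙ ωtuple 𝓐 as ∈ W (relationsⁱ e)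
  rel∈W {n} r as h = subst (λ i → _ ∈ W i) (sym r≡) (proj₁ I.relations (n , r , as , ∙≡⟨⟩ n (ωtuple 𝓐 as) , h))

  nonrel∈W : ∀ {n} (r : n ∈ Rel) as → ¬ rel r as → n ∙ ωtuple 𝓐 as ∈ W (nonrelationsⁱ e)
  nonrel∈W {n} r as h = subst (λ i → _ ∈ W i) (sym s≡) (proj₁ I.nonrelations (n , r , as , ∙≡⟨⟩ n (ωtuple 𝓐 as) , h))

  fun∈W : ∀ {m} (f : m ∈ Fun) as → m ∙ ωtuple 𝓐 as ∙ proj₁ (fun f as) ∈ W (functionsⁱ e)
  fun∈W {m} f as = subst (λ i → _ ∈ W i) (sym f≡) (proj₁ I.functions (m , f , as , ∙∙≡⟨⟩ m (ωtuple 𝓐 as) (proj₁ (fun f as))))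

  ωtuple-injective : ∀ {n} (as bs : Vec (∃ dom) n) → ωtuple 𝓐 as ≡ ωtuple 𝓐 bs → as ≡ bs
  ωtuple-injective as bs e = map-proj₁-injective dom-irrelevant as bs (tuple-injective _ _ e)

  ∈W⇒rel : ∀ {n t} → n ∙ t ∈ W (relationsⁱ e) →
           ∃[ r ] ∃[ as ] t ≡ ωtuple 𝓐 as × rel {n} r as
  ∈W⇒rel h with proj₂ I.relations (subst (λ i → _ ∈ W i) r≡ h)
  ... | n , r , as , e , p with ∙-injective (trans e (sym (∙≡⟨⟩ n (ωtuple 𝓐 as))))
  ... | refl , t≡ = r , as , t≡ , p

  ∈W⇒nonrel : ∀ {n t} → n ∙ t ∈ W (nonrelationsⁱ e) →
              ∃[ r ] ∃[ as ] t ≡ ωtuple 𝓐 as × ¬ rel {n} r as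
  ∈W⇒nonrel h with proj₂ I.nonrelations (subst (λ i → _ ∈ W i) s≡ h)
  ... | n , r , as , e , p with ∙-injective (trans e (sym (∙≡⟨⟩ n (ωtuple 𝓐 as))))
  ... | refl , t≡ = r , as , t≡ , p

  ∈W⇒fun : ∀ {m t c} → m ∙ t ∙ c ∈ W (functionsⁱ e) →
           ∃[ f ] ∃[ as ] t ≡ ωtuple 𝓐 as × c ≡ proj₁ (fun {m} f as)
  ∈W⇒fun h with proj₂ I.functions (subst (λ i → _ ∈ W i) f≡ h)
  ... | m , f , as , e with ∙-injective (trans e (sym (∙∙≡⟨⟩ m (ωtuple 𝓐 as) (proj₁ (fun f as)))))
  ... | refl , e′ with ∙-injective e′
  ... | t≡ , c≡ = f , as , t≡ , c≡

  -- Derivations speak only of numbers; occurrence in the diagram is what turns them back into a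
  -- well-formed application.
  fun-symbol : ∀ {n m c} (as : Vec (∃ dom) n) → m ∙ ωtuple 𝓐 as ∙ c ∈ W (functionsⁱ e) → m ∈ Fun × n ≡ arity m
  fun-symbol as h with ∈W⇒fun h
  ... | f , bs , t≡ , _ = f , tuple-length (vmap proj₁ as) (vmap proj₁ bs) t≡

  rel-symbol : ∀ {n m} (as : Vec (∃ dom) n) → m ∙ ωtuple 𝓐 as ∈ W (relationsⁱ e) → m ∈ Rel × n ≡ arity m
  rel-symbol as h with ∈W⇒rel h
  ... | r , bs , t≡ , _ = r , tuple-length (vmap proj₁ as) (vmap proj₁ bs) t≡

  fun-value : ∀ {m c} (f : m ∈ Fun) as → m ∙ ωtuple 𝓐 as ∙ c ∈ W (functionsⁱ e) → c ≡ proj₁ (fun f as)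
  fun-value f as h with ∈W⇒fun h
  ... | g , bs , t≡ , c≡ =
    trans c≡ (cong₂ (λ g bs → proj₁ (fun g bs)) (Fun-irrelevant g f) (sym (ωtuple-injective as bs t≡)))

  rel-holds : ∀ {m} (r : m ∈ Rel) as → m ∙ ωtuple 𝓐 as ∈ W (relationsⁱ e) → rel r as
  rel-holds r as h with ∈W⇒rel h
  ... | s , bs , t≡ , p = subst₂ rel (Rel-irrelevant s r) (sym (ωtuple-injective as bs t≡)) p

  rel-fails : ∀ {m} (r : m ∈ Rel) as → m ∙ ωtuple 𝓐 as ∈ W (nonrelationsⁱ e) → ¬ rel r as
  rel-fails r as h with ∈W⇒nonrel h
  ... | s , bs , t≡ , np =
    np ∘ subst₂ rel (sym (Rel-irrelevant s r)) (ωtuple-injective as bs t≡)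

-- Comparing atomic types

-- The parameters are decision procedures for two domains. Being a pair of equally long tuples from
-- these domains and failing to be one both need a positive definition; the second relies on the
-- output 0 of the procedures.
matched mismatched : List (Clause 2)
matched =
  clause 0 (lit 0 · lit 0) [] ⊤ᶠ ∷
  clause 4 (suc (v₀ · v₁) · suc (v₂ · v₃)) (v₁ · v₃ ∷ [])
    (sub φᶠ (v₄ ∷ v₀ ∷ lit 1 ∷ []) ∧ sub φᶠ (v₅ ∷ v₂ ∷ lit 1 ∷ [])) ∷
  []
mismatched =
  clause 1 (lit 0 · suc v₀) [] ⊤ᶠ ∷
  clause 1 (suc v₀ · lit 0) [] ⊤ᶠ ∷
  clause 4 (suc (v₀ · v₁) · suc (v₂ · v₃)) [] (sub φᶠ (v₄ ∷ v₀ ∷ lit 0 ∷ [])) ∷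
  clause 4 (suc (v₀ · v₁) · suc (v₂ · v₃)) [] (sub φᶠ (v₅ ∷ v₂ ∷ lit 0 ∷ [])) ∷
  clause 4 (suc (v₀ · v₁) · suc (v₂ · v₃)) (v₁ · v₃ ∷ []) ⊤ᶠ ∷
  []

module Matching {P Q : Pred ℕ 0ℓ} {d₀ d₁} (P-dec : d₀ Decides P) (Q-dec : d₁ Decides Q) where

  γ : Vec ℕ 2
  γ = d₀ ∷ d₁ ∷ []

  Match : ℕ → ℕ → Set
  Match v z = ∃[ n ] Σ[ as ∈ Vec (∃ P) n ] Σ[ bs ∈ Vec (∃ Q) n ] v ≡ tuple (vmap proj₁ as) × z ≡ tuple (vmap proj₁ bs)

  ∈-decided : ∀ {d} {P : Pred ℕ 0ℓ} → d Decides P → ∀ {x} → sat φᶠ (d ∷ x ∷ 1 ∷ []) → x ∈ P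
  ∈-decided dec {x} h with from (dec x 1) (to (sat-φ _ x 1) h)
  ... | inj₁ (p , _) = p

  ∉-decided : ∀ {d} {P : Pred ℕ 0ℓ} → d Decides P → ∀ {x} → sat φᶠ (d ∷ x ∷ 0 ∷ []) → x ∉ P
  ∉-decided dec {x} h with from (dec x 0) (to (sat-φ _ x 0) h)
  ... | inj₂ (p , _) = p

  decided-∈ : ∀ {d} {P : Pred ℕ 0ℓ} → d Decides P → ∀ {x} → x ∈ P → sat φᶠ (d ∷ x ∷ 1 ∷ [])
  decided-∈ dec {x} p = from (sat-φ _ x 1) (to (dec x 1) (inj₁ (p , refl)))

  decided-∉ : ∀ {d} {P : Pred ℕ 0ℓ} → d Decides P → ∀ {x} → x ∉ P → sat φᶠ (d ∷ x ∷ 0 ∷ [])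
  decided-∉ dec {x} p = from (sat-φ _ x 0) (to (dec x 0) (inj₂ (p , refl)))

  matched⇒ : ∀ {y v z} → Derivable matched γ y → y ≡ v ∙ z → Match v z
  matched⇒ (by c0 [] refl _ []) e with ∙-injective e
  ... | refl , refl = 0 , [] , [] , refl , refl
  matched⇒ (by c1 (a ∷ v ∷ b ∷ z ∷ []) refl (p , q) (d ∷ [])) e with ∙-injective e | matched⇒ d refl
  ... | refl , refl | n , as , bs , refl , refl =
    suc n , (a , ∈-decided P-dec p) ∷ as , (b , ∈-decided Q-dec q) ∷ bs ,
    sym (tuple-∷ a _) , sym (tuple-∷ b _)

  ⇒matched : ∀ {n} (as : Vec (∃ P) n) (bs : Vec (∃ Q) n) →
             Derivable matched γ (tuple (vmap proj₁ as) ∙ tuple (vmap proj₁ bs))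
  ⇒matched []             []             = by c0 [] refl refl []
  ⇒matched ((a , p) ∷ as) ((b , q) ∷ bs) = by c1 (a ∷ _ ∷ b ∷ _ ∷ [])
    (cong₂ _∙_ (tuple-∷ a _) (tuple-∷ b _)) (decided-∈ P-dec p , decided-∈ Q-dec q) (⇒matched as bs ∷ [])

  private
    tuple-∷⁻¹ : ∀ {n x v} y (ys : Vec ℕ n) → suc (x ∙ v) ≡ tuple (y ∷ ys) → x ≡ y × v ≡ tuple ys
    tuple-∷⁻¹ y ys e = ∙-injective (suc-injective (trans e (tuple-∷ y ys)))

  mismatched⇒ : ∀ {n y} (as : Vec (∃ P) n) (bs : Vec (∃ Q) n) → Derivable mismatched γ y →
                y ≢ tuple (vmap proj₁ as) ∙ tuple (vmap proj₁ bs)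
  mismatched⇒ []      []      (by c0 (_ ∷ []) refl _ _) e = contradiction (proj₂ (∙-injective e)) λ ()
  mismatched⇒ (_ ∷ _) (_ ∷ _) (by c0 (_ ∷ []) refl _ _) e = contradiction (proj₁ (∙-injective e)) λ ()
  mismatched⇒ []      []      (by c1 (_ ∷ []) refl _ _) e = contradiction (proj₁ (∙-injective e)) λ ()
  mismatched⇒ (_ ∷ _) (_ ∷ _) (by c1 (_ ∷ []) refl _ _) e = contradiction (proj₂ (∙-injective e)) λ ()
  mismatched⇒ []      []      (by c2 (_ ∷ _ ∷ _ ∷ _ ∷ []) refl _ _) e = contradiction (proj₁ (∙-injective e)) λ ()
  mismatched⇒ []      []      (by c3 (_ ∷ _ ∷ _ ∷ _ ∷ []) refl _ _) e = contradiction (proj₁ (∙-injective e)) λ ()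
  mismatched⇒ []      []      (by c4 (_ ∷ _ ∷ _ ∷ _ ∷ []) refl _ _) e = contradiction (proj₁ (∙-injective e)) λ ()
  mismatched⇒ ((a , p) ∷ as) (_ ∷ _) (by c2 (_ ∷ _ ∷ _ ∷ _ ∷ []) refl s _) e
    with tuple-∷⁻¹ a (vmap proj₁ as) (proj₁ (∙-injective e))
  ... | refl , _ = ∉-decided P-dec s p
  mismatched⇒ (_ ∷ _) ((b , q) ∷ bs) (by c3 (_ ∷ _ ∷ _ ∷ _ ∷ []) refl s _) e
    with tuple-∷⁻¹ b (vmap proj₁ bs) (proj₂ (∙-injective e))
  ... | refl , _ = ∉-decided Q-dec s q
  mismatched⇒ ((a , _) ∷ as) ((b , _) ∷ bs) (by c4 (_ ∷ _ ∷ _ ∷ _ ∷ []) refl _ (d ∷ [])) e =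
    mismatched⇒ as bs d (cong₂ _∙_
      (proj₂ (tuple-∷⁻¹ a (vmap proj₁ as) (proj₁ (∙-injective e))))
      (proj₂ (tuple-∷⁻¹ b (vmap proj₁ bs) (proj₂ (∙-injective e)))))

  -- Comparing the lists entry by entry must end at a difference of lengths or at an entry outside
  -- its domain.
  unmatched : ExcludedMiddle 0ℓ → ∀ xs ys → ¬ Match (list xs) (list ys) → Derivable mismatched γ (list xs ∙ list ys)
  unmatched em []       []       ¬m = contradiction (0 , [] , [] , refl , refl) ¬m
  unmatched em []       (y ∷ ys) ¬m = by c0 (_ ∷ []) refl refl []
  unmatched em (x ∷ xs) []       ¬m = by c1 (_ ∷ []) refl refl []
  unmatched em (x ∷ xs) (y ∷ ys) ¬m with em {x ∈ P} | em {y ∈ Q}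
  ... | no np | _     = by c2 (x ∷ _ ∷ y ∷ _ ∷ []) refl (decided-∉ P-dec np) []
  ... | yes _ | no nq = by c3 (x ∷ _ ∷ y ∷ _ ∷ []) refl (decided-∉ Q-dec nq) []
  ... | yes p | yes q = by c4 (x ∷ _ ∷ y ∷ _ ∷ []) refl refl
    (unmatched em xs ys (λ (n , as , bs , e , e′) → ¬m (suc n , (x , p) ∷ as , (y , q) ∷ bs ,
      trans (cong (λ t → suc (x ∙ t)) e) (sym (tuple-∷ x _)) ,
      trans (cong (λ t → suc (y ∙ t)) e′) (sym (tuple-∷ y _)))) ∷ [])

  ¬match⇒mismatched : ExcludedMiddle 0ℓ → ∀ v z → ¬ Match v z → Derivable mismatched γ (v ∙ z)
  ¬match⇒mismatched em v z ¬m with list-surjective v | list-surjective z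
  ... | xs , refl | ys , refl = unmatched em xs ys ¬m

-- 0 · c · d says that c and d are the values of a common term at the tuples v
-- and z, and 1 · c · d that c and d code the values of a common tuple of terms.
pairᵗ tuplesᵗ : ∀ {n} → Tm n → Tm n → Tm n
pairᵗ   c d = lit 0 · c · d
tuplesᵗ c d = lit 1 · c · d

paired : List (Clause 4)
paired =
  -- The side condition keeps the position inside the first tuple; the second is as long.
  clause 1 (pairᵗ (headᵗ (dropᵗ v₁ v₀)) (headᵗ (dropᵗ v₂ v₀))) [] (dropᵗ v₁ v₀ ≭ lit 0) ∷
  clause 5 (pairᵗ v₃ v₄) (tuplesᵗ v₁ v₂ ∷ [])
    ((v₀ · v₁ · v₃) ∈W functionsᵗ v₇ ∧ (v₀ · v₂ · v₄) ∈W functionsᵗ v₈) ∷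
  clause 0 (tuplesᵗ (lit 0) (lit 0)) [] ⊤ᶠ ∷
  clause 4 (tuplesᵗ (suc (v₀ · v₂)) (suc (v₁ · v₃))) (pairᵗ v₀ v₁ ∷ tuplesᵗ v₂ v₃ ∷ []) ⊤ᶠ ∷
  []

-- In order: a value paired with two values on the right, one paired with two on the left, a
-- relation that holds only on the left, one that holds only on the right. Failure is read from the
-- negative diagram.
disagreementᶠ : Fm 4
disagreementᶠ =
  ∃ᶠ (∃ᶠ (∃ᶠ (derives 3 paired (pairᵗ v₀ v₁) ∧ derives 3 paired (pairᵗ v₀ v₂) ∧ v₁ ≭ v₂))) ∨
  ∃ᶠ (∃ᶠ (∃ᶠ (derives 3 paired (pairᵗ v₁ v₀) ∧ derives 3 paired (pairᵗ v₂ v₀) ∧ v₁ ≭ v₂))) ∨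
  ∃ᶠ (∃ᶠ (∃ᶠ (derives 3 paired (tuplesᵗ v₁ v₂) ∧ (v₀ · v₁) ∈W relationsᵗ v₅ ∧ (v₀ · v₂) ∈W nonrelationsᵗ v₆))) ∨
  ∃ᶠ (∃ᶠ (∃ᶠ (derives 3 paired (tuplesᵗ v₁ v₂) ∧ (v₀ · v₁) ∈W nonrelationsᵗ v₅ ∧ (v₀ · v₂) ∈W relationsᵗ v₆)))

module Pairing {L : Language} {𝓐 𝓑 : ωStructure L} {e₀ e₁}
               (I₀ : e₀ IndexesComputable 𝓐) (I₁ : e₁ IndexesComputable 𝓑)
               {k} (a : Vec (∃ (ωStructure.dom 𝓐)) k) (b : Vec (∃ (ωStructure.dom 𝓑)) k) where
  open Language L
  private
    module A = ωStructure 𝓐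
    module B = ωStructure 𝓑
    module DA = Diagrams 𝓐 I₀
    module DB = Diagrams 𝓑 I₁

  evA : Term L k → ∃ A.dom
  evA = eval A.structure a

  evB : Term L k → ∃ B.dom
  evB = eval B.structure b

  evsA : ∀ {n} → Vec (Term L k) n → Vec (∃ A.dom) n
  evsA = evals A.structure a

  evsB : ∀ {n} → Vec (Term L k) n → Vec (∃ B.dom) n
  evsB = evals B.structure b

  v z : ℕ
  v = ωtuple 𝓐 a
  z = ωtuple 𝓑 b

  γ : Vec ℕ 4
  γ = v ∷ z ∷ e₀ ∷ e₁ ∷ []

  app-values : ∀ {m n c d} (ts : Vec (Term L k) n) →
               m ∙ ωtuple 𝓐 (evsA ts) ∙ c ∈ W (functionsⁱ e₀) →
               m ∙ ωtuple 𝓑 (evsB ts) ∙ d ∈ W (functionsⁱ e₁) →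
               ∃[ t ] c ≡ proj₁ (evA t) × d ≡ proj₁ (evB t)
  app-values ts p q with DA.fun-symbol (evsA ts) p
  ... | f , refl = app f ts , DA.fun-value f (evsA ts) p , DB.fun-value f (evsB ts) q

  -- A derivation is turned into the term or tuple of terms that it evaluates. Clauses for the other
  -- tag are excluded through the equation for `y`.
  paired⇒terms  : ∀ {y c d} → Derivable paired γ y → y ≡ 0 ∙ c ∙ d →
                  ∃[ t ] c ≡ proj₁ (evA t) × d ≡ proj₁ (evB t)
  paired⇒tuples : ∀ {y c d} → Derivable paired γ y → y ≡ 1 ∙ c ∙ d →
                  ∃[ n ] Σ[ ts ∈ Vec (Term L k) n ] c ≡ ωtuple 𝓐 (evsA ts) × d ≡ ωtuple 𝓑 (evsB ts)
  paired⇒terms (by c0 (j ∷ []) refl ne []) e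
    with drop-tuple-index (vmap proj₁ a) j ne | ∙-injective (proj₂ (∙-injective e))
  ... | i , refl | c≡ , d≡ = var i ,
    trans (sym c≡) (trans (nth-tuple (vmap proj₁ a) i) (lookup-map i proj₁ a)) ,
    trans (sym d≡) (trans (nth-tuple (vmap proj₁ b) i) (lookup-map i proj₁ b))
  paired⇒terms (by c1 (m ∷ _ ∷ _ ∷ c ∷ d ∷ []) refl (p , q) (ds ∷ [])) e
    with paired⇒tuples ds refl | ∙-injective (proj₂ (∙-injective e))
  ... | n , ts , refl , refl | refl , refl = app-values ts (to (sat-W _ _) p) (to (sat-W _ _) q)
  paired⇒terms (by c2 [] refl _ _) e = contradiction (proj₁ (∙-injective e)) λ ()
  paired⇒terms (by c3 (_ ∷ _ ∷ _ ∷ _ ∷ []) refl _ _) e = contradiction (proj₁ (∙-injective e)) λ ()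
  paired⇒tuples (by c0 (_ ∷ []) refl _ _) e = contradiction (proj₁ (∙-injective e)) λ ()
  paired⇒tuples (by c1 (_ ∷ _ ∷ _ ∷ _ ∷ _ ∷ []) refl _ _) e = contradiction (proj₁ (∙-injective e)) λ ()
  paired⇒tuples (by c2 [] refl _ []) e with ∙-injective (proj₂ (∙-injective e))
  ... | refl , refl = 0 , [] , refl , refl
  paired⇒tuples (by c3 (c ∷ d ∷ _ ∷ _ ∷ []) refl _ (p ∷ ps ∷ [])) e
    with ∙-injective (proj₂ (∙-injective e)) | paired⇒terms p refl | paired⇒tuples ps refl
  ... | refl , refl | t , refl , refl | n , ts , refl , refl =
    suc n , t ∷ ts , sym (tuple-∷ c _) , sym (tuple-∷ d _)

  terms-paired  : ∀ t → Derivable paired γ (0 ∙ proj₁ (evA t) ∙ proj₁ (evB t))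
  tuples-paired : ∀ {n} (ts : Vec (Term L k) n) → Derivable paired γ (1 ∙ ωtuple 𝓐 (evsA ts) ∙ ωtuple 𝓑 (evsB ts))
  terms-paired (var i) = by c0 (toℕ i ∷ [])
    (cong (0 ∙_) (cong₂ _∙_
      (sym (trans (nth-tuple (vmap proj₁ a) i) (lookup-map i proj₁ a)))
      (sym (trans (nth-tuple (vmap proj₁ b) i) (lookup-map i proj₁ b)))))
    (drop-tuple≢0 (vmap proj₁ a) i) []
  terms-paired (app {m} f ts) = by c1 (m ∷ _ ∷ _ ∷ _ ∷ _ ∷ []) refl
    (from (sat-W _ _) (DA.fun∈W f (evsA ts)) , from (sat-W _ _) (DB.fun∈W f (evsB ts)))
    (tuples-paired ts ∷ [])
  tuples-paired []       = by c2 [] refl refl []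
  tuples-paired (t ∷ ts) = by c3 (_ ∷ _ ∷ _ ∷ _ ∷ [])
    (cong (1 ∙_) (cong₂ _∙_ (tuple-∷ _ _) (tuple-∷ _ _))) refl (terms-paired t ∷ tuples-paired ts ∷ [])

  SameType : Set
  SameType = SameAtomicType A.structure B.structure a b

  private
    derivation : ∀ {j} t (δ : Vec ℕ j) → sat (derives j paired t) (δ ++ γ) → Derivable paired γ (val t (δ ++ γ))
    derivation t δ = to (sat-derives paired t δ γ)

    underivation : ∀ {j} t (δ : Vec ℕ j) → Derivable paired γ (val t (δ ++ γ)) → sat (derives j paired t) (δ ++ γ)
    underivation t δ = from (sat-derives paired t δ γ)

    A-≡ : {x y : ∃ A.dom} → proj₁ x ≡ proj₁ y → x ≡ y
    A-≡ = ∃-≡ A.dom-irrelevant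

    B-≡ : {x y : ∃ B.dom} → proj₁ x ≡ proj₁ y → x ≡ y
    B-≡ = ∃-≡ B.dom-irrelevant

  -- The terms `s` and `t` behind the two derivations give the atomic formula `s ≈ t`, which holds
  -- on the left and so on the right.
  paired-functional : SameType → ∀ {c d d′} → Derivable paired γ (0 ∙ c ∙ d) → Derivable paired γ (0 ∙ c ∙ d′) → d ≡ d′
  paired-functional same p q with paired⇒terms p refl | paired⇒terms q refl
  ... | s , c≡ , refl | t , c≡′ , refl = cong proj₁ (to (same (s ≈ t)) (A-≡ (trans (sym c≡) c≡′)))

  paired-injective : SameType → ∀ {c c′ d} → Derivable paired γ (0 ∙ c ∙ d) → Derivable paired γ (0 ∙ c′ ∙ d) → c ≡ c′
  paired-injective same p q with paired⇒terms p refl | paired⇒terms q refl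
  ... | s , refl , d≡ | t , refl , d≡′ = cong proj₁ (from (same (s ≈ t)) (B-≡ (trans (sym d≡) d≡′)))

  paired-preserves : SameType → ∀ {n c d} → Derivable paired γ (1 ∙ c ∙ d) →
                     n ∙ c ∈ W (relationsⁱ e₀) → ¬ n ∙ d ∈ W (nonrelationsⁱ e₁)
  paired-preserves same p h h′ with paired⇒tuples p refl
  ... | n , ts , refl , refl with DA.rel-symbol (evsA ts) h
  ... | r , refl = DB.rel-fails r (evsB ts) h′ (to (same (app r ts)) (DA.rel-holds r (evsA ts) h))

  paired-reflects : SameType → ∀ {n c d} → Derivable paired γ (1 ∙ c ∙ d) →
                    n ∙ c ∈ W (nonrelationsⁱ e₀) → ¬ n ∙ d ∈ W (relationsⁱ e₁)
  paired-reflects same p h h′ with paired⇒tuples p refl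
  ... | n , ts , refl , refl with DB.rel-symbol (evsB ts) h′
  ... | r , refl = DA.rel-fails r (evsA ts) h (from (same (app r ts)) (DB.rel-holds r (evsB ts) h′))

  disagreement⇒ : sat disagreementᶠ γ → ¬ SameType
  -- Witnesses come from the outermost quantifier inwards, while an environment starts with the
  -- innermost variable.
  disagreement⇒ (inj₁ (x , y , w , p , q , ne)) same = ne (paired-functional same
    (derivation (pairᵗ v₀ v₁) (w ∷ y ∷ x ∷ []) p) (derivation (pairᵗ v₀ v₂) (w ∷ y ∷ x ∷ []) q))
  disagreement⇒ (inj₂ (inj₁ (x , y , w , p , q , ne))) same = ne (paired-injective same
    (derivation (pairᵗ v₁ v₀) (w ∷ y ∷ x ∷ []) p) (derivation (pairᵗ v₂ v₀) (w ∷ y ∷ x ∷ []) q))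
  disagreement⇒ (inj₂ (inj₂ (inj₁ (x , y , w , p , q , r)))) same = paired-preserves same
    (derivation (tuplesᵗ v₁ v₂) (w ∷ y ∷ x ∷ []) p) (to (sat-W _ _) q) (to (sat-W _ _) r)
  disagreement⇒ (inj₂ (inj₂ (inj₂ (x , y , w , p , q , r)))) same = paired-reflects same
    (derivation (tuplesᵗ v₁ v₂) (w ∷ y ∷ x ∷ []) p) (to (sat-W _ _) q) (to (sat-W _ _) r)

  module _ (em : ExcludedMiddle 0ℓ) (agree : ¬ sat disagreementᶠ γ) where

    agree-functional : ∀ {c d d′} → Derivable paired γ (0 ∙ c ∙ d) → Derivable paired γ (0 ∙ c ∙ d′) → d ≡ d′
    agree-functional {c} {d} {d′} p q with d ≟ d′
    ... | yes e = e
    ... | no ne = contradiction (inj₁ (d′ , d , c ,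
      underivation (pairᵗ v₀ v₁) (c ∷ d ∷ d′ ∷ []) p , underivation (pairᵗ v₀ v₂) (c ∷ d ∷ d′ ∷ []) q , ne)) agree

    agree-injective : ∀ {c c′ d} → Derivable paired γ (0 ∙ c ∙ d) → Derivable paired γ (0 ∙ c′ ∙ d) → c ≡ c′
    agree-injective {c} {c′} {d} p q with c ≟ c′
    ... | yes e = e
    ... | no ne = contradiction (inj₂ (inj₁ (c′ , c , d ,
      underivation (pairᵗ v₁ v₀) (d ∷ c ∷ c′ ∷ []) p , underivation (pairᵗ v₂ v₀) (d ∷ c ∷ c′ ∷ []) q , ne))) agree

    -- Every failure of an equivalence would provide one of the four disjuncts. For relations,
    -- excluded middle turns not holding into membership in the negative diagram.
    agree⇒same : SameType
    agree⇒same (s ≈ t) = mk⇔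
      (λ e → B-≡ (agree-functional (terms-paired s)
        (subst (λ x → Derivable paired γ (0 ∙ proj₁ x ∙ proj₁ (evB t))) (sym e) (terms-paired t))))
      (λ e → A-≡ (agree-injective (terms-paired s)
        (subst (λ x → Derivable paired γ (0 ∙ proj₁ (evA t) ∙ proj₁ x)) (sym e) (terms-paired t))))
    agree⇒same (app {n} r ts) = mk⇔ forth back
      where
      c = ωtuple 𝓐 (evsA ts)
      d = ωtuple 𝓑 (evsB ts)
      tuples : sat (derives 3 paired (tuplesᵗ v₁ v₂)) (n ∷ c ∷ d ∷ γ)
      tuples = underivation (tuplesᵗ v₁ v₂) (n ∷ c ∷ d ∷ []) (tuples-paired ts)
      forth : A.structure ⊨ app r ts [ a ] → B.structure ⊨ app r ts [ b ]
      forth p with em {B.structure ⊨ app r ts [ b ]}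
      ... | yes q = q
      ... | no nq = contradiction (inj₂ (inj₂ (inj₁ (d , c , n , tuples ,
        from (sat-W _ _) (DA.rel∈W r (evsA ts) p) , from (sat-W _ _) (DB.nonrel∈W r (evsB ts) nq))))) agree
      back : B.structure ⊨ app r ts [ b ] → A.structure ⊨ app r ts [ a ]
      back q with em {A.structure ⊨ app r ts [ a ]}
      ... | yes p = p
      ... | no np = contradiction (inj₂ (inj₂ (inj₂ (d , c , n , tuples ,
        from (sat-W _ _) (DA.nonrel∈W r (evsA ts) np) , from (sat-W _ _) (DB.rel∈W r (evsB ts) q))))) agree

-- Certificates for uniformly finite ages

-- The code of the list bounds all its positions; those past the end satisfy the first disjunct.
∀∈ᶠ : ∀ {n} → Fin n → Fm (suc n) → Fm n
∀∈ᶠ s φ = ∀< (var s) (dropᵗ (var (suc s)) v₀ ≐ lit 0 ∨ sub φ (headᵗ (dropᵗ (var (suc s)) v₀) ∷ weaken 1))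

sat-∀∈ : ∀ {n} (s : Fin n) φ γ xs → lookup γ s ≡ list xs → sat (∀∈ᶠ s φ) γ ⇔ (∀ x → x ∈ˡ xs → sat φ (x ∷ γ))
sat-∀∈ s φ γ xs s≡ = mk⇔ forth back
  where
  entry : ∀ xs x → x ∈ˡ xs → ∃[ i ] i < list xs × drop (list xs) i ≢ 0 × head (drop (list xs) i) ≡ x
  entry (y ∷ xs) x (here refl) = 0 , z<s , (λ ()) , π₁-∙ y (list xs)
  entry (y ∷ xs) x (there x∈) with entry xs x x∈
  ... | i , i< , ne , e = suc i , s<s (<-≤-trans i< (∙-≥ʳ y (list xs))) ,
    ne ∘ trans (sym (drop-∷ y (list xs) i)) , trans (cong head (drop-∷ y (list xs) i)) e
  forth : sat (∀∈ᶠ s φ) γ → ∀ x → x ∈ˡ xs → sat φ (x ∷ γ)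
  forth h x x∈ with entry xs x x∈
  ... | i , i< , ne , e with h i (subst (i <_) (sym s≡) i<)
  ... | inj₁ e₀ = contradiction (trans (cong (λ s → drop s i) (sym s≡)) e₀) ne
  ... | inj₂ p  = subst₂ (λ x γ → sat φ (x ∷ γ))
    (trans (cong (λ s → head (drop s i)) s≡) e) (vals-weaken (i ∷ []) γ) p
  back : (∀ x → x ∈ˡ xs → sat φ (x ∷ γ)) → sat (∀∈ᶠ s φ) γ
  back h i i< with drop (lookup γ s) i ≟ 0
  ... | yes e = inj₁ e
  ... | no ne = inj₂ (subst (λ γ′ → sat φ (head (drop (lookup γ s) i) ∷ γ′)) (sym (vals-weaken (i ∷ []) γ))
    (h (head (drop (lookup γ s) i)) (to (sat-member xs (sym s≡)) (i , ne , refl))))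

consᶠ : ∀ {p} → Fm (3 + p) → Fm (4 + p)
consᶠ φ = sub φ (suc (fst v₀ · v₁) ∷ suc (snd v₀ · v₂) ∷ weaken 3)

-- Lengthens both tuples by the components of an arbitrary pair from the list, which is the third
-- variable.
extendᶠ : ∀ {p} → Fm (3 + p) → Fm (3 + p)
extendᶠ φ = ∀∈ᶠ (suc (suc zero)) (consᶠ φ)

-- φ at the two tuples formed by the components of any n pairs in a list; the
-- first three variables of φ are the two tuples and the list.
∀tuplesᶠ : ∀ {p} → ℕ → Fm (3 + p) → Fm (1 + p)
∀tuplesᶠ zero    φ = sub φ (lit 0 ∷ lit 0 ∷ weaken 0)
∀tuplesᶠ (suc n) φ = ∀tuplesᶠ n (extendᶠ φ)

sat-∀tuples : ∀ {p} n (φ : Fm (3 + p)) xs γ → sat (∀tuplesᶠ n φ) (list xs ∷ γ) ⇔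
              (∀ (ps : Vec ℕ n) → Allᵛ (_∈ˡ xs) ps →
               sat φ (tuple (vmap π₁ ps) ∷ tuple (vmap π₂ ps) ∷ list xs ∷ γ))
sat-∀tuples zero    φ xs γ = mk⇔
  (λ { h [] _ → subst (λ γ → sat φ (0 ∷ 0 ∷ γ)) (vals-weaken [] (list xs ∷ γ)) h })
  (λ h → subst (λ γ → sat φ (0 ∷ 0 ∷ γ)) (sym (vals-weaken [] (list xs ∷ γ))) (h [] []ᵛ))
sat-∀tuples {p} (suc n) φ xs γ = mk⇔ forth back
  where
  δ : Vec ℕ n → Vec ℕ (3 + p)
  δ ps = tuple (vmap π₁ ps) ∷ tuple (vmap π₂ ps) ∷ list xs ∷ γ
  cons : ∀ x ps → sat (consᶠ φ) (x ∷ δ ps) ≡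
                  sat φ (tuple (vmap π₁ (x ∷ ps)) ∷ tuple (vmap π₂ (x ∷ ps)) ∷ list xs ∷ γ)
  cons x ps = cong (sat φ) (cong₂ _∷_ (sym (tuple-∷ (π₁ x) (vmap π₁ ps)))
    (cong₂ _∷_ (sym (tuple-∷ (π₂ x) (vmap π₂ ps)))
      (vals-weaken (x ∷ tuple (vmap π₁ ps) ∷ tuple (vmap π₂ ps) ∷ []) (list xs ∷ γ))))
  extended : ∀ ps → sat (extendᶠ φ) (δ ps) ⇔ (∀ x → x ∈ˡ xs → sat (consᶠ φ) (x ∷ δ ps))
  extended ps = sat-∀∈ (suc (suc zero)) (consᶠ φ) (δ ps) xs refl
  Instances : Set
  Instances = ∀ (ps : Vec ℕ (suc n)) → Allᵛ (_∈ˡ xs) ps →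
              sat φ (tuple (vmap π₁ ps) ∷ tuple (vmap π₂ ps) ∷ list xs ∷ γ)
  forth : sat (∀tuplesᶠ n (extendᶠ φ)) (list xs ∷ γ) → Instances
  forth h (x ∷ ps) (x∈ ∷ᵛ ps∈) =
    subst id (cons x ps) (to (extended ps) (to (sat-∀tuples n (extendᶠ φ) xs γ) h ps ps∈) x x∈)
  back : Instances → sat (∀tuplesᶠ n (extendᶠ φ)) (list xs ∷ γ)
  back h = from (sat-∀tuples n (extendᶠ φ) xs γ) λ ps ps∈ →
    from (extended ps) λ x x∈ → subst id (sym (cons x ps)) (h (x ∷ ps) (x∈ ∷ᵛ ps∈))

-- A form without implication of the condition that a set of pairs be the graph of an injection.
compatibleᶠ : ∀ {n} → Fm (2 + n)
compatibleᶠ = fst v₁ ≐ fst v₀ ∧ snd v₁ ≐ snd v₀ ∨ fst v₁ ≭ fst v₀ ∧ snd v₁ ≭ snd v₀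

-- The variables are the list of pairs, the two tuples and the two indices.
baseᶠ injectiveᶠ : Fm 5
baseᶠ = ∀< v₁ (dropᵗ v₂ v₀ ≐ lit 0 ∨ (headᵗ (dropᵗ v₂ v₀) · headᵗ (dropᵗ v₃ v₀)) ∈ᶠ v₁)
injectiveᶠ = ∀∈ᶠ zero (∀∈ᶠ (suc zero) compatibleᶠ)

-- Two argument tuples precede the variables of `baseᶠ`. Agreement on a relation means two
-- memberships in positive diagrams or two in negative ones, so it stays Σ₁.
closedᶠ agreeᶠ : ℕ → Fm 7
closedᶠ m = ∃ᶠ (∃ᶠ ((lit m · v₂ · v₁) ∈W functionsᵗ v₇ ∧ (lit m · v₃ · v₀) ∈W functionsᵗ v₈ ∧ (v₁ · v₀) ∈ᶠ v₄))
agreeᶠ n =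
  (lit n · v₀) ∈W relationsᵗ v₅ ∧ (lit n · v₁) ∈W relationsᵗ v₆ ∨
  (lit n · v₀) ∈W nonrelationsᵗ v₅ ∧ (lit n · v₁) ∈W nonrelationsᵗ v₆

-- Which listed numbers are symbols is settled while the formula is built, not within it. As the
-- list is finite, excluded middle may settle it.
whenᶠ : ∀ {A : Set} {n} → Dec A → Fm n → Fm n
whenᶠ (yes _) φ = φ
whenᶠ (no _)  φ = ⊤ᶠ

sat-when : ∀ {A : Set} {n} (d : Dec A) (φ : Fm n) γ → sat (whenᶠ d φ) γ ⇔ (A → sat φ γ)
sat-when (yes a) φ γ = mk⇔ (λ p _ → p) (λ h → h a)
sat-when (no na) φ γ = mk⇔ (λ _ a → contradiction a na) (λ _ → refl)

module Certificates (em : ExcludedMiddle 0ℓ) (L : Language) where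
  open Language L

  symbolᶠ : ℕ → Fm 5
  symbolᶠ n = whenᶠ (em {n ∈ Fun}) (∀tuplesᶠ (arity n) (closedᶠ n)) ∧
              whenᶠ (em {n ∈ Rel}) (∀tuplesᶠ (arity n) (agreeᶠ n))

  symbolsᶠ : List ℕ → Fm 5
  symbolsᶠ []       = ⊤ᶠ
  symbolsᶠ (n ∷ ns) = symbolᶠ n ∧ symbolsᶠ ns

  sat-symbols : ∀ ns γ → sat (symbolsᶠ ns) γ ⇔ (∀ n → n ∈ˡ ns → sat (symbolᶠ n) γ)
  sat-symbols []       γ = mk⇔ (λ _ n ()) (λ _ → refl)
  sat-symbols (n ∷ ns) γ = mk⇔
    (λ { (p , q) n (here refl) → p ; (p , q) n (there n∈) → to (sat-symbols ns γ) q n n∈ })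
    (λ h → h n (here refl) , from (sat-symbols ns γ) (λ n n∈ → h n (there n∈)))

  certificateᶠ : List ℕ → Fm 4
  certificateᶠ ns = ∃ᶠ (baseᶠ ∧ injectiveᶠ ∧ symbolsᶠ ns)

  module Correct (ns : List ℕ) (finite : ∀ n → n ∈ Rel ⊎ n ∈ Fun → n ∈ˡ ns)
                 {𝓐 𝓑 : ωStructure L} {e₀ e₁}
                 (I₀ : e₀ IndexesComputable 𝓐) (I₁ : e₁ IndexesComputable 𝓑)
                 {k} (a : Vec (∃ (ωStructure.dom 𝓐)) k) (b : Vec (∃ (ωStructure.dom 𝓑)) k) where
    open Pairing I₀ I₁ a b
    private
      module A = ωStructure 𝓐
      module B = ωStructure 𝓑
      module DA = Diagrams 𝓐 I₀
      module DB = Diagrams 𝓑 I₁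

    valuesᵗ : Term L k → ℕ
    valuesᵗ t = proj₁ (evA t) ∙ proj₁ (evB t)

    π₁-values : ∀ {n} (ts : Vec (Term L k) n) → vmap π₁ (vmap valuesᵗ ts) ≡ vmap proj₁ (evsA ts)
    π₁-values []       = refl
    π₁-values (t ∷ ts) = cong₂ _∷_ (π₁-∙ _ _) (π₁-values ts)

    π₂-values : ∀ {n} (ts : Vec (Term L k) n) → vmap π₂ (vmap valuesᵗ ts) ≡ vmap proj₁ (evsB ts)
    π₂-values []       = refl
    π₂-values (t ∷ ts) = cong₂ _∷_ (π₂-∙ _ _) (π₂-values ts)

    At : Fm 7 → List ℕ → ∀ {n} → Vec (Term L k) n → Set
    At φ xs ts = sat φ (ωtuple 𝓐 (evsA ts) ∷ ωtuple 𝓑 (evsB ts) ∷ list xs ∷ γ)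

    at-values : ∀ φ xs {n} (ts : Vec (Term L k) n) →
                sat φ (tuple (vmap π₁ (vmap valuesᵗ ts)) ∷ tuple (vmap π₂ (vmap valuesᵗ ts)) ∷ list xs ∷ γ) ≡
                At φ xs ts
    at-values φ xs ts = cong₂ (λ c d → sat φ (tuple c ∷ tuple d ∷ list xs ∷ γ)) (π₁-values ts) (π₂-values ts)

    module _ (xs : List ℕ) (base : sat baseᶠ (list xs ∷ γ)) (inj : sat injectiveᶠ (list xs ∷ γ))
             (symbols : sat (symbolsᶠ ns) (list xs ∷ γ)) where

      injective : ∀ {p q} → p ∈ˡ xs → q ∈ˡ xs → π₁ p ≡ π₁ q × π₂ p ≡ π₂ q ⊎ π₁ p ≢ π₁ q × π₂ p ≢ π₂ q
      injective {p} {q} p∈ q∈ = to (sat-∀∈ (suc zero) compatibleᶠ (p ∷ list xs ∷ γ) xs refl)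
        (to (sat-∀∈ zero (∀∈ᶠ (suc zero) compatibleᶠ) (list xs ∷ γ) xs refl) inj p p∈) q q∈

      closed : ∀ {m} → m ∈ Fun → (ts : Vec (Term L k) (arity m)) → Allᵛ (_∈ˡ xs) (vmap valuesᵗ ts) →
               At (closedᶠ m) xs ts
      closed {m} f ts ts∈ = subst id (at-values (closedᶠ m) xs ts)
        (to (sat-∀tuples (arity m) (closedᶠ m) xs γ)
          (to (sat-when em _ _) (proj₁ (to (sat-symbols ns _) symbols m (finite m (inj₂ f)))) f)
          (vmap valuesᵗ ts) ts∈)

      agree : ∀ {n} → n ∈ Rel → (ts : Vec (Term L k) (arity n)) → Allᵛ (_∈ˡ xs) (vmap valuesᵗ ts) →
              At (agreeᶠ n) xs ts
      agree {n} r ts ts∈ = subst id (at-values (agreeᶠ n) xs ts)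
        (to (sat-∀tuples (arity n) (agreeᶠ n) xs γ)
          (to (sat-when em _ _) (proj₂ (to (sat-symbols ns _) symbols n (finite n (inj₁ r)))) r)
          (vmap valuesᵗ ts) ts∈)

      -- Variables are covered by `baseᶠ`, applications by `closedᶠ`.
      values∈  : ∀ t → valuesᵗ t ∈ˡ xs
      valuess∈ : ∀ {n} (ts : Vec (Term L k) n) → Allᵛ (_∈ˡ xs) (vmap valuesᵗ ts)
      values∈ (var i) with base (toℕ i) (index<tuple (vmap proj₁ a) i)
      ... | inj₁ e = contradiction e (drop-tuple≢0 (vmap proj₁ a) i)
      ... | inj₂ p = subst (_∈ˡ xs)
        (cong₂ _∙_ (trans (nth-tuple (vmap proj₁ a) i) (lookup-map i proj₁ a))
                   (trans (nth-tuple (vmap proj₁ b) i) (lookup-map i proj₁ b)))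
        (to (sat-member xs refl) p)
      values∈ (app f ts) with closed f ts (valuess∈ ts)
      ... | c , d , p , q , r = subst (_∈ˡ xs)
        (cong₂ _∙_ (DA.fun-value f (evsA ts) (to (sat-W _ _) p)) (DB.fun-value f (evsB ts) (to (sat-W _ _) q)))
        (to (sat-member xs refl) r)
      valuess∈ []       = []ᵛ
      valuess∈ (t ∷ ts) = values∈ t ∷ᵛ valuess∈ ts

      certificate⇒same : SameType
      certificate⇒same (s ≈ t) with injective (values∈ s) (values∈ t)
      ... | r rewrite π₁-∙ (proj₁ (evA s)) (proj₁ (evB s)) | π₂-∙ (proj₁ (evA s)) (proj₁ (evB s))
                    | π₁-∙ (proj₁ (evA t)) (proj₁ (evB t)) | π₂-∙ (proj₁ (evA t)) (proj₁ (evB t)) with r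
      ... | inj₁ (e , e′)   = mk⇔ (λ _ → ∃-≡ B.dom-irrelevant e′) (λ _ → ∃-≡ A.dom-irrelevant e)
      ... | inj₂ (ne , ne′) = mk⇔ (λ e → contradiction (cong proj₁ e) ne) (λ e → contradiction (cong proj₁ e) ne′)
      certificate⇒same (app r ts) = go (agree r ts (valuess∈ ts))
        where
        go : At (agreeᶠ _) xs ts → _
        go (inj₁ (p , q)) = mk⇔ (λ _ → DB.rel-holds r (evsB ts) (to (sat-W _ _) q))
                                (λ _ → DA.rel-holds r (evsA ts) (to (sat-W _ _) p))
        go (inj₂ (p , q)) = mk⇔ (λ h → contradiction h (DA.rel-fails r (evsA ts) (to (sat-W _ _) p)))
                                (λ h → contradiction h (DB.rel-fails r (evsB ts) (to (sat-W _ _) q)))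

    -- Finiteness on the left suffices: under `SameType` the left value of a term determines the
    -- right one.
    Finite : Set
    Finite = ∃[ ys ] (∀ t → evA t ∈ˡ ys)

    module _ (same : SameType) where

      Values : List ℕ → Set
      Values xs = ∀ p → p ∈ˡ xs → ∃[ t ] p ≡ valuesᵗ t

      -- For each listed element that is the value of some term, one such term is kept; any other
      -- term with that value has the same right value as well. `Values` ensures that nothing else
      -- is in the list.
      values-list : Finite → ∃[ xs ] (∀ t → valuesᵗ t ∈ˡ xs) × Values xs
      values-list (ys , ys∋) = let xs , xs∋ , xs-values = go ys in xs , (λ t → xs∋ t (ys∋ t)) , xs-values
        where
        go : ∀ ys → ∃[ xs ] (∀ t → evA t ∈ˡ ys → valuesᵗ t ∈ˡ xs) × Values xs
        go []       = [] , (λ _ ()) , (λ _ ())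
        go (y ∷ ys) with go ys | em {∃[ t ] evA t ≡ y}
        ... | xs , xs∋ , xs-values | no ∄t =
          xs , (λ { t (here e) → contradiction (t , e) ∄t ; t (there t∈) → xs∋ t t∈ }) , xs-values
        ... | xs , xs∋ , xs-values | yes (s , refl) = valuesᵗ s ∷ xs ,
          (λ { t (here e) → here (cong₂ _∙_ (cong proj₁ e) (cong proj₁ (to (same (t ≈ s)) e)))
             ; t (there t∈) → there (xs∋ t t∈) }) ,
          λ { _ (here refl) → s , refl ; p (there p∈) → xs-values p p∈ }

      module _ (xs : List ℕ) (xs∋ : ∀ t → valuesᵗ t ∈ˡ xs) (xs-values : Values xs) where

        base : sat baseᶠ (list xs ∷ γ)
        base j _ with drop v j ≟ 0
        ... | yes e = inj₁ e
        ... | no ne with drop-tuple-index (vmap proj₁ a) j ne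
        ... | i , refl = inj₂ (from (sat-member xs refl) (subst (_∈ˡ xs)
          (cong₂ _∙_ (sym (trans (nth-tuple (vmap proj₁ a) i) (lookup-map i proj₁ a)))
                     (sym (trans (nth-tuple (vmap proj₁ b) i) (lookup-map i proj₁ b))))
          (xs∋ (var i))))

        compatible : ∀ s t → sat (compatibleᶠ {1}) (valuesᵗ t ∷ valuesᵗ s ∷ list xs ∷ [])
        compatible s t with proj₁ (evA s) ≟ proj₁ (evA t)
        ... | yes e = inj₁
          (trans (π₁-∙ _ _) (trans e (sym (π₁-∙ _ _))) ,
           trans (π₂-∙ _ _) (trans (cong proj₁ (to (same (s ≈ t)) (∃-≡ A.dom-irrelevant e))) (sym (π₂-∙ _ _))))
        ... | no ne = inj₂
          ((λ e → ne (trans (sym (π₁-∙ _ _)) (trans e (π₁-∙ _ _)))) ,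
           (λ e → ne (cong proj₁ (from (same (s ≈ t))
             (∃-≡ B.dom-irrelevant (trans (sym (π₂-∙ _ _)) (trans e (π₂-∙ _ _))))))))

        inj : sat injectiveᶠ (list xs ∷ γ)
        inj = from (sat-∀∈ zero (∀∈ᶠ (suc zero) compatibleᶠ) (list xs ∷ γ) xs refl) λ p p∈ →
              from (sat-∀∈ (suc zero) compatibleᶠ (p ∷ list xs ∷ γ) xs refl) λ q q∈ → pair-of p q (xs-values p p∈) (xs-values q q∈)
          where
          pair-of : ∀ p q → ∃[ s ] p ≡ valuesᵗ s → ∃[ t ] q ≡ valuesᵗ t → sat compatibleᶠ (q ∷ p ∷ list xs ∷ γ)
          pair-of _ _ (s , refl) (t , refl) = compatible s t

        terms : ∀ {n} (ps : Vec ℕ n) → Allᵛ (_∈ˡ xs) ps → ∃[ ts ] ps ≡ vmap valuesᵗ ts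
        terms []       _            = [] , refl
        terms (p ∷ ps) (p∈ ∷ᵛ ps∈) with xs-values p p∈ | terms ps ps∈
        ... | t , refl | ts , refl = t ∷ ts , refl

        -- All entries of the list are values of terms, so its tuples of pairs come from tuples of
        -- terms.
        ∀terms : ∀ n φ → (∀ ts → At φ xs ts) → sat (∀tuplesᶠ n φ) (list xs ∷ γ)
        ∀terms n φ h = from (sat-∀tuples n φ xs γ) λ ps ps∈ → at ps (terms ps ps∈)
          where
          at : ∀ ps → ∃[ ts ] ps ≡ vmap valuesᵗ ts → sat φ (tuple (vmap π₁ ps) ∷ tuple (vmap π₂ ps) ∷ list xs ∷ γ)
          at _ (ts , refl) = subst id (sym (at-values φ xs ts)) (h ts)

        closed′ : ∀ {m} (f : m ∈ Fun) ts → At (closedᶠ m) xs ts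
        closed′ f ts = proj₁ (evA (app f ts)) , proj₁ (evB (app f ts)) ,
          from (sat-W _ _) (DA.fun∈W f (evsA ts)) , from (sat-W _ _) (DB.fun∈W f (evsB ts)) ,
          from (sat-member xs refl) (xs∋ (app f ts))

        agree′ : ∀ {n} (r : n ∈ Rel) ts → At (agreeᶠ n) xs ts
        agree′ r ts with em {A.structure ⊨ app r ts [ a ]}
        ... | yes p = inj₁ (from (sat-W _ _) (DA.rel∈W r (evsA ts) p) ,
                            from (sat-W _ _) (DB.rel∈W r (evsB ts) (to (same (app r ts)) p)))
        ... | no np = inj₂ (from (sat-W _ _) (DA.nonrel∈W r (evsA ts) np) ,
                            from (sat-W _ _) (DB.nonrel∈W r (evsB ts) (np ∘ from (same (app r ts)))))

        symbol : ∀ n → sat (symbolᶠ n) (list xs ∷ γ)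
        symbol n = from (sat-when em _ _) (λ f → ∀terms (arity n) (closedᶠ n) (closed′ f)) ,
                   from (sat-when em _ _) (λ r → ∀terms (arity n) (agreeᶠ n) (agree′ r))

    sat-certificate : Finite → sat (certificateᶠ ns) γ ⇔ SameType
    sat-certificate fin = mk⇔ forth back
      where
      forth : sat (certificateᶠ ns) γ → SameType
      forth (l , p , q , r) with list-surjective l
      ... | xs , refl = certificate⇒same xs p q r
      back : SameType → sat (certificateᶠ ns) γ
      back same = let xs , xs∋ , xs-values = values-list same fin in
        list xs , base same xs xs∋ xs-values , inj same xs xs∋ xs-values ,
        from (sat-symbols ns _) λ n _ → symbol same xs xs∋ xs-values n

-- Embedding information

eval∈Cl : ∀ {L : Language} (𝓜 : Structure L) {k} (a : Vec (Structure.Carrier 𝓜) k) t → eval 𝓜 a t ∈ Cl 𝓜 a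
evals∈Cl : ∀ {L : Language} (𝓜 : Structure L) {k} (a : Vec (Structure.Carrier 𝓜) k) {n} (ts : Vec (Term L k) n) →
           Allᵛ (Cl 𝓜 a) (evals 𝓜 a ts)
eval∈Cl 𝓜 a (var i)    = gen i
eval∈Cl 𝓜 a (app f ts) = op f (evals∈Cl 𝓜 a ts)
evals∈Cl 𝓜 a []       = []ᵛ
evals∈Cl 𝓜 a (t ∷ ts) = eval∈Cl 𝓜 a t ∷ᵛ evals∈Cl 𝓜 a ts

quadrupleᶠ : Fm 4 → Fm 1
quadrupleᶠ φ = sub φ (fst v₀ ∷ fst (snd v₀) ∷ fst (snd (snd v₀)) ∷ snd (snd (snd v₀)) ∷ [])

-- The pairing is onto, so every number is a quadruple.
define-quadruple : ∀ {B : Pred ℕ 0ℓ} φ → (∀ u v w z → u ∙ v ∙ w ∙ z ∈ B ⇔ sat φ (u ∷ v ∷ w ∷ z ∷ [])) →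
                   ∀ x → x ∈ B ⇔ sat (quadrupleᶠ φ) (x ∷ [])
define-quadruple {B} φ h x = subst (λ y → y ∈ B ⇔ sat (quadrupleᶠ φ) (x ∷ [])) x≡ (h _ _ _ _)
  where
  x≡ : π₁ x ∙ π₁ (π₂ x) ∙ π₁ (π₂ (π₂ x)) ∙ π₂ (π₂ (π₂ x)) ≡ x
  x≡ = trans (cong (λ t → π₁ x ∙ π₁ (π₂ x) ∙ t) (∙-π _)) (trans (cong (π₁ x ∙_) (∙-π _)) (∙-π x))

module EI (em : ExcludedMiddle 0ℓ) {ℓ} {L : Language} {K : Pred (Structure L) ℓ} (𝔎 : ComputableAge K) where
  open ComputableAge 𝔎
  open ωStructure using (dom)

  private
    𝕂-index : ℕ
    𝕂-index = proj₁ 𝕂-ce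

  𝕀≡ : ∀ i → 𝕀 i ≡ ωtuple (𝓐 i) (a i) ∙ index i ∙ i
  𝕀≡ i = sym (∙∙≡⟨⟩ _ (index i) i)

  index-𝕀 : ∀ i → π₁ (π₂ (𝕀 i)) ≡ index i
  index-𝕀 i = trans (cong π₁ (trans (cong π₂ (𝕀≡ i)) (π₂-∙ _ (index i ∙ i)))) (π₁-∙ (index i) i)

  number-𝕀 : ∀ i → π₂ (π₂ (𝕀 i)) ≡ i
  number-𝕀 i = trans (cong π₂ (trans (cong π₂ (𝕀≡ i)) (π₂-∙ _ (index i ∙ i)))) (π₂-∙ (index i) i)

  𝕀-computable : ∀ i → π₁ (π₂ (𝕀 i)) IndexesComputable 𝓐 i
  𝕀-computable i = subst (_IndexesComputable 𝓐 i) (sym (index-𝕀 i)) (computable i)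

  ∈W⇔𝕀 : ∀ {u} → u ∈ W 𝕂-index ⇔ (∃[ i ] u ≡ 𝕀 i)
  ∈W⇔𝕀 = mk⇔ (proj₁ triples ∘ proj₂ (proj₂ 𝕂-ce)) (proj₁ (proj₂ 𝕂-ce) ∘ proj₂ triples)

  nontripleᶠ : Fm 1
  nontripleᶠ = ∃ᶠ (v₀ ∈W lit 𝕂-index ∧ snd (snd v₀) ≐ snd (snd v₁) ∧ v₀ ≭ v₁)

  -- Some triple in the enumeration has the same third entry as `u`, and it is the only one; `u` is
  -- compared with it.
  sat-nontriple : ∀ u → sat nontripleᶠ (u ∷ []) ⇔ (¬ (∃[ i ] u ≡ 𝕀 i))
  sat-nontriple u = mk⇔ forth back
    where
    forth : sat nontripleᶠ (u ∷ []) → ¬ (∃[ i ] u ≡ 𝕀 i)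
    forth (t , p , e , ne) (i , refl) with to ∈W⇔𝕀 (to (sat-W _ _) p)
    ... | j , refl = ne (cong 𝕀 (trans (sym (number-𝕀 j)) (trans e (number-𝕀 i))))
    back : ¬ (∃[ i ] u ≡ 𝕀 i) → sat nontripleᶠ (u ∷ [])
    back h = 𝕀 i , from (sat-W _ _) (from ∈W⇔𝕀 (i , refl)) , number-𝕀 i , λ e → h (i , sym e)
      where i = π₂ (π₂ u)

  Same : ∀ k₀ k₁ {n} → Vec (∃ (dom (𝓐 k₀))) n → Vec (∃ (dom (𝓐 k₁))) n → Set
  Same k₀ k₁ = SameAtomicType (∣𝓐∣ k₀) (∣𝓐∣ k₁)

  -- Componentwise equations can be matched with `refl`, unlike the single one in `EmbeddingInfo`.
  Quadruple : (u v w z : ℕ) → Set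
  Quadruple u v w z = ∃[ k₀ ] ∃[ k₁ ] ∃[ n ] ∃[ b₀ ] ∃[ b₁ ] Same k₀ k₁ {n} b₀ b₁ ×
    u ≡ 𝕀 k₀ × v ≡ ωtuple (𝓐 k₀) b₀ × w ≡ 𝕀 k₁ × z ≡ ωtuple (𝓐 k₁) b₁

  EI⇔ : ∀ u v w z → u ∙ v ∙ w ∙ z ∈ EmbeddingInfo ⇔ Quadruple u v w z
  EI⇔ u v w z = mk⇔ forth back
    where
    4-tuple : ∀ u v w z → u ∙ v ∙ w ∙ z ≡ ⟨ u , ⟨ v , ⟨ w , z ⟩ ⟩ ⟩
    4-tuple u v w z = trans (∙≡⟨⟩ u _) (cong ⟨ u ,_⟩ (∙∙≡⟨⟩ v w z))
    forth : u ∙ v ∙ w ∙ z ∈ EmbeddingInfo → Quadruple u v w z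
    forth (k₀ , k₁ , n , b₀ , b₁ , same , e)
      with u≡ , e₁ ← ∙-injective (trans e (sym (4-tuple (𝕀 k₀) (ωtuple (𝓐 k₀) b₀) (𝕀 k₁) (ωtuple (𝓐 k₁) b₁))))
      with v≡ , e₂ ← ∙-injective e₁
      with w≡ , z≡ ← ∙-injective e₂
      = k₀ , k₁ , n , b₀ , b₁ , same , u≡ , v≡ , w≡ , z≡
    back : Quadruple u v w z → u ∙ v ∙ w ∙ z ∈ EmbeddingInfo
    back (k₀ , k₁ , n , b₀ , b₁ , same , refl , refl , refl , refl) =
      k₀ , k₁ , n , b₀ , b₁ , same , 4-tuple (𝕀 k₀) (ωtuple (𝓐 k₀) b₀) (𝕀 k₁) (ωtuple (𝓐 k₁) b₁)

  module M k₀ k₁ = Matching (Diagrams.domain (𝓐 k₀) (𝕀-computable k₀)) (Diagrams.domain (𝓐 k₁) (𝕀-computable k₁))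
  module P k₀ k₁ {n} (b₀ : Vec (∃ (dom (𝓐 k₀))) n) (b₁ : Vec (∃ (dom (𝓐 k₁))) n) =
    Pairing (𝕀-computable k₀) (𝕀-computable k₁) b₀ b₁

  indexᵗ : ∀ {n} → Tm n → Tm n
  indexᵗ u = fst (snd u)

  matchᶠ : List (Clause 2) → Fm 4
  matchᶠ cs = sub (derivableᶠ cs) (v₁ · v₃ ∷ domainᵗ (indexᵗ v₀) ∷ domainᵗ (indexᵗ v₂) ∷ [])

  atᶠ : Fm 4 → Fm 4
  atᶠ φ = sub φ (v₁ ∷ v₃ ∷ indexᵗ v₀ ∷ indexᵗ v₂ ∷ [])

  complementᶠ : Fm 4
  complementᶠ = sub nontripleᶠ (v₀ ∷ []) ∨ sub nontripleᶠ (v₂ ∷ []) ∨ matchᶠ mismatched ∨ atᶠ disagreementᶠ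

  -- Each disjunct is considered once the preceding ones have failed: triples provide the domains in
  -- which tuples are matched, and matched tuples have types to compare. Conversely every disjunct
  -- refutes a quadruple by itself.
  sat-complement : ∀ u v w z → u ∙ v ∙ w ∙ z ∉ EmbeddingInfo ⇔ sat complementᶠ (u ∷ v ∷ w ∷ z ∷ [])
  sat-complement u v w z = mk⇔ forth (λ p → back p ∘ to (EI⇔ u v w z))
    where
    forth : u ∙ v ∙ w ∙ z ∉ EmbeddingInfo → sat complementᶠ (u ∷ v ∷ w ∷ z ∷ [])
    forth ∉EI with em {∃[ i ] u ≡ 𝕀 i} | em {∃[ i ] w ≡ 𝕀 i}
    ... | no ∄i | _ = inj₁ (from (sat-nontriple u) ∄i)
    ... | yes _ | no ∄i = inj₂ (inj₁ (from (sat-nontriple w) ∄i))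
    ... | yes (k₀ , refl) | yes (k₁ , refl) with em {M.Match k₀ k₁ v z}
    ... | no ¬m = inj₂ (inj₂ (inj₁ (from (sat-derivable _ mismatched _) (M.¬match⇒mismatched k₀ k₁ em v z ¬m))))
    ... | yes (n , b₀ , b₁ , refl , refl) with em {sat disagreementᶠ (P.γ k₀ k₁ b₀ b₁)}
    ... | yes p = inj₂ (inj₂ (inj₂ p))
    ... | no np = contradiction (from (EI⇔ _ _ _ _)
      (k₀ , k₁ , n , b₀ , b₁ , P.agree⇒same k₀ k₁ b₀ b₁ em np , refl , refl , refl , refl)) ∉EI
    back : sat complementᶠ (u ∷ v ∷ w ∷ z ∷ []) → ¬ Quadruple u v w z
    back (inj₁ p) (k₀ , k₁ , n , b₀ , b₁ , same , refl , refl , refl , refl) = to (sat-nontriple _) p (k₀ , refl)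
    back (inj₂ (inj₁ p)) (k₀ , k₁ , n , b₀ , b₁ , same , refl , refl , refl , refl) = to (sat-nontriple _) p (k₁ , refl)
    back (inj₂ (inj₂ (inj₁ p))) (k₀ , k₁ , n , b₀ , b₁ , same , refl , refl , refl , refl) =
      M.mismatched⇒ k₀ k₁ b₀ b₁ (to (sat-derivable _ mismatched _) p) refl
    back (inj₂ (inj₂ (inj₂ p))) (k₀ , k₁ , n , b₀ , b₁ , same , refl , refl , refl , refl) =
      P.disagreement⇒ k₀ k₁ b₀ b₁ p same

  EI≤T𝟎′ : EmbeddingInfo ≤T 𝟎′
  EI≤T𝟎′ = co-Σ₁⇒≤T𝟎′ em (quadrupleᶠ complementᶠ) (define-quadruple {_∉ EmbeddingInfo} complementᶠ sat-complement)

  module _ (uf : UniformlyFinite K) where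
    open Certificates em L

    private
      symbols : List ℕ
      symbols = proj₁ (proj₁ uf)

    embeddingᶠ : Fm 4
    embeddingᶠ = v₀ ∈W lit 𝕂-index ∧ v₂ ∈W lit 𝕂-index ∧ matchᶠ matched ∧ atᶠ (certificateᶠ symbols)

    module C k₀ k₁ {n} (b₀ : Vec (∃ (dom (𝓐 k₀))) n) (b₁ : Vec (∃ (dom (𝓐 k₁))) n) =
      Correct symbols (proj₂ (proj₁ uf)) (𝕀-computable k₀) (𝕀-computable k₁) b₀ b₁

    -- The values of terms lie in the closure of the tuple, which is finite because the structure
    -- belongs to `K`.
    finite : ∀ k₀ k₁ {n} b₀ b₁ → C.Finite k₀ k₁ {n} b₀ b₁
    finite k₀ k₁ b₀ b₁ with proj₂ (proj₂ (proj₂ uf)) (sound k₀) b₀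
    ... | ys , _ , ys∋ = ys , λ t → ys∋ (eval∈Cl (∣𝓐∣ k₀) b₀ t)

    sat-embedding : ∀ u v w z → u ∙ v ∙ w ∙ z ∈ EmbeddingInfo ⇔ sat embeddingᶠ (u ∷ v ∷ w ∷ z ∷ [])
    sat-embedding u v w z = mk⇔ (forth ∘ to (EI⇔ u v w z)) (from (EI⇔ u v w z) ∘ back)
      where
      forth : Quadruple u v w z → sat embeddingᶠ (u ∷ v ∷ w ∷ z ∷ [])
      forth (k₀ , k₁ , n , b₀ , b₁ , same , refl , refl , refl , refl) =
        from (sat-W _ _) (from ∈W⇔𝕀 (k₀ , refl)) , from (sat-W _ _) (from ∈W⇔𝕀 (k₁ , refl)) ,
        from (sat-derivable _ matched _) (M.⇒matched k₀ k₁ b₀ b₁) ,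
        from (C.sat-certificate k₀ k₁ b₀ b₁ (finite k₀ k₁ b₀ b₁)) same
      back : sat embeddingᶠ (u ∷ v ∷ w ∷ z ∷ []) → Quadruple u v w z
      back (p , q , m , c) with to ∈W⇔𝕀 (to (sat-W _ _) p) | to ∈W⇔𝕀 (to (sat-W _ _) q)
      ... | k₀ , refl | k₁ , refl with M.matched⇒ k₀ k₁ (to (sat-derivable _ matched _) m) refl
      ... | n , b₀ , b₁ , refl , refl =
        k₀ , k₁ , n , b₀ , b₁ , to (C.sat-certificate k₀ k₁ b₀ b₁ (finite k₀ k₁ b₀ b₁)) c , refl , refl , refl , refl

    EI-computable : Computable EmbeddingInfo
    EI-computable = post (quadrupleᶠ embeddingᶠ) (quadrupleᶠ complementᶠ) (λ x → em)
      (define-quadruple embeddingᶠ sat-embedding) (define-quadruple {_∉ EmbeddingInfo} complementᶠ sat-complement)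

lemma5p5 : ExcludedMiddle 0ℓ → ∀ {ℓ} (L : Language) (K : Pred (Structure L) ℓ) (𝔎 : ComputableAge K) →
    (ComputableAge.EmbeddingInfo 𝔎 ≤T 𝟎′) ×
    (UniformlyFinite K → Computable (ComputableAge.EmbeddingInfo 𝔎))
lemma5p5 em L K 𝔎 = EI.EI≤T𝟎′ em 𝔎 , EI.EI-computable em 𝔎
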